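{- For every real $\alpha < 8$, infinitely many positive integers $k$ collapse for $\mathcal{C}_{\overline{\alpha}}$. For every real $\alpha \ge 8$, every positive integer $k$ is forcing for $\mathcal{C}_{\overline{\alpha}}$.
   Context: All graphs are finite and simple. For a graph $G$, a weighing is a function $w: E(G) \to \{ -1,1\}$, and for a subgraph $H$, $w(H)=\sum_{e\in E(H)} w(e)$. For a positive integer $k$, $w$ is $k$-local positive if $w(H)>0$ for every connected subgraph $H$ of $G$ with exactly $k$ edges. Let $\mathcal{G}$ be an infinite family of connected graphs. $k$ is forcing for $\mathcal{G}$ if for all but finitely many $G \in \mathcal{G}$, every $k$-local positive weighing $w$ of $G$ satisfies $w(G)>0$. $k$ is weakly forcing for $\mathcal{G}$ if it is not forcing but there is a constant $C$ such that for all but finitely many $G\in\mathcal{G}$, every $k$-local positive weighing $w$ of $G$ has $w(G)\ge C$. $k$ collapses for $\mathcal{G}$ if it is neither forcing nor weakly forcing. $\mathcal{C}_{\overline{\alpha}}$ denotes the family of all connected graphs with average degree at least $\alpha$. -}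

module Defs where

open import Data.Nat as ℕ using (ℕ; zero; suc; _<ᵇ_)
open import Data.Fin using (Fin; toℕ)
open import Data.Bool using (Bool; true; false; if_then_else_; _∧_; _∨_)
open import Data.Integer as ℤ using (ℤ; +_; _◃_)
open import Data.Sign using (Sign)
open import Data.Rational as ℚ using (ℚ; _/_)
open import Data.Product using (Σ; _×_; ∃; ∃-syntax; _,_)
open import Data.Sum using (_⊎_)
open import Relation.Nullary using (¬_)
open import Data.Empty using (⊥)
open import Relation.Binary.PropositionalEquality using (_≡_)

record ℝ : Set₁ where
  field
    lower    : ℚ → Set
    upper    : ℚ → Set
    lower-inhabited : ∃[ q ] lower q
    upper-inhabited : ∃[ q ] upper q
    lower-rounded : ∀ q → lower q → ∃[ r ] (q ℚ.< r × lower r)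
    lower-closed  : ∀ q r → q ℚ.< r → lower r → lower q
    upper-rounded : ∀ q → upper q → ∃[ r ] (r ℚ.< q × upper r)
    upper-closed  : ∀ q r → q ℚ.< r → upper q → upper r
    disjoint : ∀ q → lower q → upper q → ⊥
    located  : ∀ q r → q ℚ.< r → lower q ⊎ upper r
open ℝ public

-- Comparisons between a real α and a rational x (the usual cut order,
-- with x embedded as the cut {q < x} / {x < q}).
_≤ʳ_ : ℝ → ℚ → Set
α ≤ʳ x = ∀ q → lower α q → q ℚ.< x

_<ʳ_ : ℝ → ℚ → Set
α <ʳ x = ∃[ q ] (upper α q × q ℚ.< x)

_≥ʳ_ : ℝ → ℚ → Set
α ≥ʳ x = ∀ q → q ℚ.< x → lower α q

record Graph : Set where
  field
    n      : ℕ
    adj    : Fin n → Fin n → Bool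
    sym    : ∀ i j → adj i j ≡ adj j i
    irrefl : ∀ i → adj i i ≡ false
open Graph public

ΣFin : (m : ℕ) → (Fin m → ℤ) → ℤ
ΣFin zero    f = + 0
ΣFin (suc m) f = f Fin.zero ℤ.+ ΣFin m (λ i → f (Fin.suc i))
  where import Data.Fin as Fin

ΣFinℕ : (m : ℕ) → (Fin m → ℕ) → ℕ
ΣFinℕ zero    f = 0
ΣFinℕ (suc m) f = f Fin.zero ℕ.+ ΣFinℕ m (λ i → f (Fin.suc i))
  where import Data.Fin as Fin

data Reach {m : ℕ} (A : Fin m → Fin m → Bool) : Fin m → Fin m → Set where
  here : ∀ {i} → Reach A i i
  step : ∀ {i j k} → A i j ≡ true → Reach A j k → Reach A i k

Connected : Graph → Set
Connected G = (0 ℕ.< n G) × (∀ u v → Reach (adj G) u v)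

numEdges : Graph → ℕ
numEdges G = ΣFinℕ (n G) (λ i → ΣFinℕ (n G) (λ j →
               if (toℕ i <ᵇ toℕ j) ∧ adj G i j then 1 else 0))

avgDeg : Graph → ℚ
avgDeg G with n G
... | zero  = ℚ.0ℚ
... | suc m = (+ (2 ℕ.* numEdges G)) / suc m

-- Subgraphs given by edge sets.  An edge {i,j} of G is represented by
-- the ordered pair (i , j) with i < j.  A set of edges is a Boolean
-- predicate S on such pairs.

IsEdgeSet : (G : Graph) → (Fin (n G) → Fin (n G) → Bool) → Set
IsEdgeSet G S = ∀ i j → S i j ≡ true →
                  ((toℕ i <ᵇ toℕ j) ≡ true) × (adj G i j ≡ true)

E : (G : Graph) → Fin (n G) → Fin (n G) → Bool
E G i j = (toℕ i <ᵇ toℕ j) ∧ adj G i j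

edgeCount : (G : Graph) → (Fin (n G) → Fin (n G) → Bool) → ℕ
edgeCount G S = ΣFinℕ (n G) (λ i → ΣFinℕ (n G) (λ j → if S i j then 1 else 0))

-- vertices of the subgraph H spanned by S: endpoints of its edges
Incident : (G : Graph) → (Fin (n G) → Fin (n G) → Bool) → Fin (n G) → Set
Incident G S v = ∃[ u ] ((S u v ≡ true) ⊎ (S v u ≡ true))

ConnectedSub : (G : Graph) → (Fin (n G) → Fin (n G) → Bool) → Set
ConnectedSub G S = ∀ u v → Incident G S u → Incident G S v →
                   Reach (λ i j → S i j ∨ S j i) u v

-- Weighings: w assigns a sign (±1) to each edge {i,j}, read at (i , j)
-- with i < j (values at other pairs are irrelevant).

Weighing : Graph → Set
Weighing G = Fin (n G) → Fin (n G) → Sign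

wt : (G : Graph) → Weighing G → (Fin (n G) → Fin (n G) → Bool) → ℤ
wt G w S = ΣFin (n G) (λ i → ΣFin (n G) (λ j →
             if S i j then w i j ◃ 1 else + 0))

LocalPos : ℕ → (G : Graph) → Weighing G → Set
LocalPos k G w = ∀ S → IsEdgeSet G S → edgeCount G S ≡ k → ConnectedSub G S →
                 + 0 ℤ.< wt G w S

InC : ℝ → Graph → Set
InC α G = Connected G × (α ≤ʳ avgDeg G)

-- "for all but finitely many G in C_α" : all G in C_α with at least N
-- vertices, for some N (there are finitely many labelled graphs of each order)
Forcing : ℝ → ℕ → Set
Forcing α k = ∃[ N ] ∀ (G : Graph) → InC α G → N ℕ.≤ n G →
              ∀ (w : Weighing G) → LocalPos k G w → + 0 ℤ.< wt G w (E G)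

WeaklyForcing : ℝ → ℕ → Set
WeaklyForcing α k = ¬ Forcing α k ×
  (∃[ C ] ∃[ N ] ∀ (G : Graph) → InC α G → N ℕ.≤ n G →
     ∀ (w : Weighing G) → LocalPos k G w → C ℤ.≤ wt G w (E G))

Collapses : ℝ → ℕ → Set
Collapses α k = ¬ Forcing α k × ¬ WeaklyForcing α k

module Submission where

-- For α ≥ 8, put h = ⌈k/2⌉ and suppose w(G) ≤ 0, so that at least 2n edges are negative; assign each
-- to one of its ends.  If some subtree with at most h vertices received h negative edges, the subtree
-- and these edges would extend to a connected k-edge subgraph of weight ≤ 0.  But a spanning tree can
-- be cut, from the leaves upwards, into subtrees with at most h vertices each of which accounts for at
-- least h/2 vertices of its own; if all are light, fewer than h negative edges per h/2 vertices leave
-- fewer than 2n in total once n is large.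
--
-- For α < 8, take k = 4s² + 1 and let many branches hang from a centre, each with 2s² negative edges
-- in a blob of O(s) vertices at the end of a positive path of length s² + 1.  A connected k-edge
-- subgraph either meets the negative edges of one branch only, or contains two such paths.  Each branch
-- has negative weight, and about 4s² edges on s² + O(s) vertices.

open import Defs renaming (sym to adj-sym)
open import Data.Bool using (Bool; true; false; if_then_else_; _∧_; _∨_; not; T)
open import Data.Bool.Properties using (∨-comm; ∨-zeroʳ; ∨-identityʳ)
open import Data.Empty using (⊥-elim)
open import Data.Fin using (Fin; zero; suc; toℕ; fromℕ<; _↑ˡ_; _↑ʳ_; combine; remQuot)
import Data.Fin.Properties as Finₚ
open import Data.Integer as ℤ using (ℤ; +_; _◃_; ∣_∣)
import Data.Integer.Properties as ℤₚ
open import Data.Nat as ℕ using (ℕ; zero; suc; _+_; _*_; _∸_; _<_; _≤_; z≤n; s≤s; _<ᵇ_; _≡ᵇ_)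
open import Data.Nat.Properties
open import Data.Nat.Tactic.RingSolver using (solve-∀)
open import Data.Product using (Σ; _×_; ∃-syntax; _,_; proj₁; proj₂)
open import Data.Rational as ℚ using (ℚ; mkℚ; _/_)
import Data.Rational.Properties as ℚₚ
import Data.Rational.Unnormalised as ℚᵘ
import Data.Rational.Unnormalised.Properties as ℚᵘₚ
open import Data.Sign using (Sign)
open import Data.Sum using (_⊎_; inj₁; inj₂)
open import Function using (_∘_; id; case_of_)
open import Relation.Binary.Definitions using (tri<; tri≈; tri>)
open import Relation.Binary.PropositionalEquality
open import Relation.Nullary using (¬_; yes; no; contradiction)
open import Relation.Nullary.Decidable using (⌊_⌋)

private variable
  m : ℕ

-- Finite sums of natural numbers.

ι : Bool → ℕ
ι b = if b then 1 else 0

ι≤1 : ∀ b → ι b ≤ 1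
ι≤1 false = z≤n
ι≤1 true  = ≤-refl

δ : Fin m → Fin m → ℕ
δ i j = ι ⌊ i Finₚ.≟ j ⌋

Σ-cong : {f g : Fin m → ℕ} → (∀ i → f i ≡ g i) → ΣFinℕ m f ≡ ΣFinℕ m g
Σ-cong {zero}  e = refl
Σ-cong {suc m} e = cong₂ _+_ (e zero) (Σ-cong (e ∘ suc))

Σ-mono : {f g : Fin m → ℕ} → (∀ i → f i ≤ g i) → ΣFinℕ m f ≤ ΣFinℕ m g
Σ-mono {zero}  e = z≤n
Σ-mono {suc m} e = +-mono-≤ (e zero) (Σ-mono (e ∘ suc))

Σ-distrib-+ : (f g : Fin m → ℕ) → ΣFinℕ m (λ i → f i + g i) ≡ ΣFinℕ m f + ΣFinℕ m g
Σ-distrib-+ {zero}  f g = refl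
Σ-distrib-+ {suc m} f g = trans (cong (λ s → f zero + g zero + s) (Σ-distrib-+ (f ∘ suc) (g ∘ suc)))
  (interchange (f zero) (g zero) (ΣFinℕ m (f ∘ suc)) (ΣFinℕ m (g ∘ suc)))
  where
  interchange : ∀ a b c d → a + b + (c + d) ≡ (a + c) + (b + d)
  interchange = solve-∀

Σ-const : ∀ m (c : ℕ) → ΣFinℕ m (λ _ → c) ≡ m * c
Σ-const zero    c = refl
Σ-const (suc m) c = cong (λ s → c + s) (Σ-const m c)

Σ-zero : {f : Fin m → ℕ} → (∀ i → f i ≡ 0) → ΣFinℕ m f ≡ 0
Σ-zero {m} e = trans (Σ-cong e) (trans (Σ-const m 0) (*-zeroʳ m))

Σ-one : ∀ m → ΣFinℕ m (λ _ → 1) ≡ m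
Σ-one m = trans (Σ-const m 1) (*-identityʳ m)

δ-suc : (i j : Fin m) → δ (suc i) (suc j) ≡ δ i j
δ-suc i j with i Finₚ.≟ j
... | yes _ = refl
... | no  _ = refl

Σ-δ : (a : Fin m) (g : Fin m → ℕ) → ΣFinℕ m (λ i → δ a i * g i) ≡ g a
Σ-δ zero g = trans
    (cong₂ _+_ (+-identityʳ (g zero)) (Σ-zero {f = λ i → δ zero (suc i) * g (suc i)} (λ _ → refl)))
    (+-identityʳ (g zero))
Σ-δ (suc a) g = trans (Σ-cong (λ i → cong (_* g (suc i)) (δ-suc a i))) (Σ-δ a (g ∘ suc))

-- Used on rows and then on entries, this finds an edge that one edge set has and another lacks.
Σ-<⇒∃ : {f g : Fin m → ℕ} → ΣFinℕ m f < ΣFinℕ m g → ∃[ i ] f i < g i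
Σ-<⇒∃ {suc m} {f} {g} lt with f zero ℕ.<? g zero
... | yes p = zero , p
... | no ¬p with Σ-<⇒∃ (+-cancelˡ-< (g zero) _ _
                   (≤-<-trans (+-monoˡ-≤ (ΣFinℕ m (f ∘ suc)) (≮⇒≥ ¬p)) lt))
...   | i , q = suc i , q

Σ-split : ∀ a {b} (f : Fin (a + b) → ℕ) →
          ΣFinℕ (a + b) f ≡ ΣFinℕ a (λ i → f (i ↑ˡ b)) + ΣFinℕ b (λ i → f (a ↑ʳ i))
Σ-split zero    f = refl
Σ-split (suc a) f = trans (cong (λ s → f zero + s) (Σ-split a (f ∘ suc))) (sym (+-assoc (f zero) _ _))

Σ-combine : ∀ M {B} (f : Fin (M * B) → ℕ) →
            ΣFinℕ (M * B) f ≡ ΣFinℕ M (λ b → ΣFinℕ B (λ p → f (combine b p)))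
Σ-combine zero        f = refl
Σ-combine (suc M) {B} f = trans (Σ-split B f)
    (cong (λ s → ΣFinℕ B (λ p → f (p ↑ˡ (M * B))) + s) (Σ-combine M (λ i → f (B ↑ʳ i))))

-- The additive form carries an edgewise identity between signed weights and natural counts over to
-- sums without subtraction.
Σ-ℤ : {a b : Fin m → ℕ} {f : Fin m → ℤ} → (∀ i → + a i ≡ f i ℤ.+ + b i) →
      + ΣFinℕ m a ≡ ΣFin m f ℤ.+ + ΣFinℕ m b
Σ-ℤ {zero}  e = refl
Σ-ℤ {suc m} {a} {b} {f} e = begin
  + a zero ℤ.+ + ΣFinℕ m (a ∘ suc)
    ≡⟨ cong₂ ℤ._+_ (e zero) (Σ-ℤ (e ∘ suc)) ⟩
  (f zero ℤ.+ + b zero) ℤ.+ (ΣFin m (f ∘ suc) ℤ.+ + ΣFinℕ m (b ∘ suc))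
    ≡⟨ interchange (f zero) (+ b zero) _ _ ⟩
  (f zero ℤ.+ ΣFin m (f ∘ suc)) ℤ.+ (+ b zero ℤ.+ + ΣFinℕ m (b ∘ suc)) ∎
  where
  open ≡-Reasoning
  open import Algebra.Properties.CommutativeSemigroup ℤₚ.+-commutativeSemigroup using (interchange)

-- Signs, edge sets and weighted counts of edges.

isNeg : Sign → Bool
isNeg Sign.- = true
isNeg Sign.+ = false

negativity : {A B : Set} → (A → B → Sign) → A → B → ℕ
negativity w i j = ι (isNeg (w i j))

EdgeSet : ℕ → Set
EdgeSet n = Fin n → Fin n → Bool

module _ {n : ℕ} where

  _⊑_ : EdgeSet n → EdgeSet n → Set
  S ⊑ S′ = ∀ i j → S i j ≡ true → S′ i j ≡ true

  count : (Fin n → Fin n → ℕ) → EdgeSet n → ℕ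
  count u S = ΣFinℕ n λ i → ΣFinℕ n λ j → if S i j then u i j else 0

  size : EdgeSet n → ℕ
  size = count (λ _ _ → 1)

  negs : (Fin n → Fin n → Sign) → EdgeSet n → ℕ
  negs w = count (negativity w)

  -- An edge is stored as a pair with the smaller end first, so this row sum assigns each negative
  -- edge to its smaller end.
  lowerNegs : (Fin n → Fin n → Sign) → EdgeSet n → Fin n → ℕ
  lowerNegs w S i = ΣFinℕ n λ j → if S i j then negativity w i j else 0

  count-mono : ∀ {u S S′} → S ⊑ S′ → count u S ≤ count u S′
  count-mono {u} {S} {S′} S⊑S′ = Σ-mono λ i → Σ-mono λ j → pointwise i j
    where
    pointwise : ∀ i j → (if S i j then u i j else 0) ≤ (if S′ i j then u i j else 0)
    pointwise i j with S i j in eq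
    ... | false = z≤n
    ... | true rewrite S⊑S′ i j eq = ≤-refl

  count-weight-≤ : ∀ {u v} S → (∀ i j → u i j ≤ v i j) → count u S ≤ count v S
  count-weight-≤ {u} {v} S u≤v = Σ-mono λ i → Σ-mono λ j → pointwise i j
    where
    pointwise : ∀ i j → (if S i j then u i j else 0) ≤ (if S i j then v i j else 0)
    pointwise i j with S i j
    ... | false = z≤n
    ... | true  = u≤v i j

  insertEdge : Fin n → Fin n → EdgeSet n → EdgeSet n
  insertEdge a b S i j = S i j ∨ (⌊ a Finₚ.≟ i ⌋ ∧ ⌊ b Finₚ.≟ j ⌋)

  insertEdge-⊒ : ∀ a b S → S ⊑ insertEdge a b S
  insertEdge-⊒ a b S i j e rewrite e = refl

  insertEdge-∈ : ∀ a b S → insertEdge a b S a b ≡ true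
  insertEdge-∈ a b S with a Finₚ.≟ a | b Finₚ.≟ b
  ... | yes _ | yes _ = ∨-zeroʳ (S a b)
  ... | no ¬p | _     = contradiction refl ¬p
  ... | yes _ | no ¬p = contradiction refl ¬p

  insertEdge-inv : ∀ a b S {i j} → insertEdge a b S i j ≡ true →
                   S i j ≡ true ⊎ (a ≡ i × b ≡ j)
  insertEdge-inv a b S {i} {j} e with S i j | a Finₚ.≟ i | b Finₚ.≟ j
  ... | true  | _     | _     = inj₁ refl
  ... | false | yes p | yes q = inj₂ (p , q)
  insertEdge-inv a b S () | false | no _  | _
  insertEdge-inv a b S () | false | yes _ | no _

  count-insertEdge : ∀ u a b S → S a b ≡ false → count u (insertEdge a b S) ≡ count u S + u a b
  count-insertEdge u a b S Sab = begin
    count u (insertEdge a b S)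
      ≡⟨ (Σ-cong λ i → trans (Σ-cong (pointwise i)) (Σ-distrib-+ (old i) (new i))) ⟩
    ΣFinℕ n (λ i → ΣFinℕ n (old i) + ΣFinℕ n (new i))
      ≡⟨ Σ-distrib-+ (λ i → ΣFinℕ n (old i)) (λ i → ΣFinℕ n (new i)) ⟩
    count u S + ΣFinℕ n (λ i → ΣFinℕ n (new i))
      ≡⟨ cong (λ s → count u S + s) (trans (Σ-cong collapse) (Σ-δ a (λ i → u i b))) ⟩
    count u S + u a b ∎
    where
    open ≡-Reasoning
    old new : Fin n → Fin n → ℕ
    old i j = if S i j then u i j else 0
    new i j = δ b j * (δ a i * u i j)
    collapse : ∀ i → ΣFinℕ n (new i) ≡ δ a i * u i b
    collapse i = Σ-δ b (λ j → δ a i * u i j)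
    pointwise : ∀ i j → (if insertEdge a b S i j then u i j else 0) ≡ old i j + new i j
    pointwise i j with a Finₚ.≟ i | b Finₚ.≟ j
    ... | yes refl | yes refl rewrite Sab = trans (sym (+-identityʳ (u i j))) (sym (+-identityʳ (u i j + 0)))
    ... | yes refl | no _ rewrite ∨-identityʳ (S i j) = sym (+-identityʳ (old i j))
    ... | no _ | yes refl rewrite ∨-identityʳ (S i j) = sym (+-identityʳ (old i j))
    ... | no _ | no _ rewrite ∨-identityʳ (S i j) = sym (+-identityʳ (old i j))

-- Each edge satisfies 1 = weight + 2·[negative]. Hence positivity of a weight means
-- `negs + negs < size`, and all later arguments count in ℕ.
size≡wt+2negs : ∀ G (w : Weighing G) S → + size S ≡ wt G w S ℤ.+ + (negs w S + negs w S)
size≡wt+2negs G w S =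
  trans (Σ-ℤ λ i → trans (Σ-ℤ (pointwise i)) (cong (λ s → ΣFin _ (ω i) ℤ.+ + s) (Σ-distrib-+ (ν i) (ν i))))
        (cong (λ s → wt G w S ℤ.+ + s) (Σ-distrib-+ (λ i → ΣFinℕ _ (ν i)) (λ i → ΣFinℕ _ (ν i))))
  where
  ν : Fin (n G) → Fin (n G) → ℕ
  ν i j = if S i j then negativity w i j else 0
  ω : Fin (n G) → Fin (n G) → ℤ
  ω i j = if S i j then w i j ◃ 1 else + 0
  pointwise : ∀ i j → + (if S i j then 1 else 0) ≡ ω i j ℤ.+ + (ν i j + ν i j)
  pointwise i j with S i j | w i j
  ... | false | _      = refl
  ... | true  | Sign.+ = refl
  ... | true  | Sign.- = refl

wt>0⇒2negs<size : ∀ G (w : Weighing G) S → + 0 ℤ.< wt G w S → negs w S + negs w S < size S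
wt>0⇒2negs<size G w S p = ℤₚ.drop‿+<+
    (subst₂ ℤ._<_ (ℤₚ.+-identityˡ _) (sym (size≡wt+2negs G w S)) (ℤₚ.+-monoˡ-< (+ (negs w S + negs w S)) p))

2negs<size⇒wt>0 : ∀ G (w : Weighing G) S → negs w S + negs w S < size S → + 0 ℤ.< wt G w S
2negs<size⇒wt>0 G w S p = ℤₚ.≰⇒> λ wt≤0 → <⇒≱ p (ℤₚ.drop‿+≤+
  (subst₂ ℤ._≤_ (sym (size≡wt+2negs G w S)) (ℤₚ.+-identityˡ _) (ℤₚ.+-monoˡ-≤ (+ (negs w S + negs w S)) wt≤0)))

-- Walks and symmetric closures.

Reach-trans : {A : EdgeSet m} → ∀ {u v x} → Reach A u v → Reach A v x → Reach A u x
Reach-trans here       q = q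
Reach-trans (step e p) q = step e (Reach-trans p q)

Reach-sym : {A : EdgeSet m} → (∀ i j → A i j ≡ A j i) → ∀ {u v} → Reach A u v → Reach A v u
Reach-sym A-sym here       = here
Reach-sym A-sym (step e p) = Reach-trans (Reach-sym A-sym p) (step (trans (A-sym _ _) e) here)

Reach-mono : {A A′ : EdgeSet m} → A ⊑ A′ → ∀ {u v} → Reach A u v → Reach A′ u v
Reach-mono A⊑A′ here       = here
Reach-mono A⊑A′ (step e p) = step (A⊑A′ _ _ e) (Reach-mono A⊑A′ p)

Reach-crosses : {A : EdgeSet m} (X : Fin m → Bool) → ∀ {u v} → Reach A u v → X u ≡ true → X v ≡ false →
                ∃[ i ] ∃[ j ] A i j ≡ true × X i ≡ true × X j ≡ false
Reach-crosses X here Xu Xv = contradiction (trans (sym Xu) Xv) λ ()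
Reach-crosses X (step {i} {j} e p) Xu Xv with X j in Xj
... | true  = Reach-crosses X p Xj Xv
... | false = i , j , e , Xu , Xj

symClosure : EdgeSet m → EdgeSet m
symClosure S i j = S i j ∨ S j i

symClosure-sym : (S : EdgeSet m) → ∀ i j → symClosure S i j ≡ symClosure S j i
symClosure-sym S i j = ∨-comm (S i j) (S j i)

symClosure-fwd : (S : EdgeSet m) → ∀ {i j} → S i j ≡ true → symClosure S i j ≡ true
symClosure-fwd S e rewrite e = refl

symClosure-bwd : (S : EdgeSet m) → ∀ {i j} → S j i ≡ true → symClosure S i j ≡ true
symClosure-bwd S {i} {j} e rewrite e = ∨-zeroʳ (S i j)

symClosure-inv : (S : EdgeSet m) → ∀ {i j} → symClosure S i j ≡ true → S i j ≡ true ⊎ S j i ≡ true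
symClosure-inv S {i} {j} e with S i j
... | true  = inj₁ refl
... | false = inj₂ e

symClosure-mono : {S S′ : EdgeSet m} → S ⊑ S′ → symClosure S ⊑ symClosure S′
symClosure-mono {S = S} {S′} S⊑S′ i j e with symClosure-inv S {i} {j} e
... | inj₁ p = symClosure-fwd S′ (S⊑S′ i j p)
... | inj₂ p = symClosure-bwd S′ (S⊑S′ j i p)

double-cancel-≤ : ∀ {x y} → x + x ≤ y + y → x ≤ y
double-cancel-≤ p = ≮⇒≥ λ y<x → <⇒≱ (+-mono-< y<x y<x) p

δ≥1⇒≡ : (i j : Fin m) → 1 ≤ δ i j → i ≡ j
δ≥1⇒≡ i j p with i Finₚ.≟ j
... | yes q = q

δ-refl : (i : Fin m) → δ i i ≡ 1
δ-refl i with i Finₚ.≟ i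
... | yes _ = refl
... | no ¬p = contradiction refl ¬p

1≤+⇒1≤⊎1≤ : ∀ a b → 1 ≤ a + b → 1 ≤ a ⊎ 1 ≤ b
1≤+⇒1≤⊎1≤ zero    b p = inj₂ p
1≤+⇒1≤⊎1≤ (suc a) b p = inj₁ (s≤s z≤n)

-- Trees in a graph

-- Hanging one tree at a time from the root gives the recursion that the cutting argument follows.
-- The type itself allows repeated vertices; `mult` counts them and `Simple` forbids them.
data Tree (A : EdgeSet m) : Fin m → Set where
  leaf  : ∀ r → Tree A r
  graft : ∀ {r c} → Tree A r → A r c ≡ true → Tree A c → Tree A r

module _ {A : EdgeSet m} where

  belowRoot : (Fin m → ℕ) → ∀ {r} → Tree A r → ℕ
  belowRoot g (leaf r)            = 0
  belowRoot g (graft {c = c} s _ t) = belowRoot g s + (g c + belowRoot g t)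

  total : (Fin m → ℕ) → ∀ {r} → Tree A r → ℕ
  total g {r} t = g r + belowRoot g t

  mult : ∀ {r} → Tree A r → Fin m → ℕ
  mult t v = total (λ u → δ u v) t

  edges : ∀ {r} → Tree A r → ℕ
  edges = belowRoot (λ _ → 1)

  total-graft : ∀ g {r c} (s : Tree A r) (e : A r c ≡ true) t →
                total g (graft s e t) ≡ total g s + total g t
  total-graft g {r} s e t = sym (+-assoc (g r) (belowRoot g s) (total g t))

  total≡Σmult : ∀ g {r} (t : Tree A r) → total g t ≡ ΣFinℕ m (λ v → mult t v * g v)
  total≡Σmult g (leaf r) = trans (+-identityʳ (g r)) (sym (trans
    (Σ-cong λ v → cong (_* g v) (+-identityʳ (δ r v))) (Σ-δ r g)))
  total≡Σmult g (graft s e t) = begin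
    total g (graft s e t)                            ≡⟨ total-graft g s e t ⟩
    total g s + total g t                            ≡⟨ cong₂ _+_ (total≡Σmult g s) (total≡Σmult g t) ⟩
    ΣFinℕ m (λ v → mult s v * g v) + ΣFinℕ m (λ v → mult t v * g v)
      ≡⟨ Σ-distrib-+ (λ v → mult s v * g v) (λ v → mult t v * g v) ⟨
    ΣFinℕ m (λ v → mult s v * g v + mult t v * g v)
      ≡⟨ (Σ-cong λ v → trans (sym (*-distribʳ-+ (g v) (mult s v) (mult t v)))
                             (cong (_* g v) (sym (total-graft (λ u → δ u v) s e t)))) ⟩
    ΣFinℕ m (λ v → mult (graft s e t) v * g v) ∎
    where open ≡-Reasoning

  -- Quantifying over all g says at once that the vertices of t′ are those of t together with c.
  attach : ∀ {r p c} (t : Tree A r) → 1 ≤ mult t p → A p c ≡ true →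
           Σ (Tree A r) λ t′ → ∀ g → total g t′ ≡ g c + total g t
  attach {p = p} {c} (leaf r) p∈t e with refl ← δ≥1⇒≡ r p (subst (1 ≤_) (+-identityʳ _) p∈t) =
    graft (leaf r) e (leaf c) , λ g → lemma (g r) (g c)
    where
    lemma : ∀ x y → x + (y + 0) ≡ y + (x + 0)
    lemma = solve-∀
  attach {p = p} {c} (graft {c = d} s a t) p∈ e with 1≤+⇒1≤⊎1≤ (mult s p) (mult t p)
                                  (subst (1 ≤_) (total-graft (λ u → δ u p) s a t) p∈)
  ... | inj₁ p∈s with s′ , eq ← attach s p∈s e = graft s′ a t , λ g → begin
      total g (graft s′ a t)          ≡⟨ total-graft g s′ a t ⟩
      total g s′ + total g t          ≡⟨ cong (_+ total g t) (eq g) ⟩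
      g c + total g s + total g t     ≡⟨ +-assoc (g c) _ _ ⟩
      g c + (total g s + total g t)   ≡⟨ cong (λ s → g c + s) (total-graft g s a t) ⟨
      g c + total g (graft s a t)     ∎
    where open ≡-Reasoning
  ... | inj₂ p∈t with t′ , eq ← attach t p∈t e = graft s a t′ , λ g → begin
      total g (graft s a t′)          ≡⟨ total-graft g s a t′ ⟩
      total g s + total g t′          ≡⟨ cong (λ x → total g s + x) (eq g) ⟩
      total g s + (g c + total g t)   ≡⟨ lemma (total g s) (g c) (total g t) ⟩
      g c + (total g s + total g t)   ≡⟨ cong (λ s → g c + s) (total-graft g s a t) ⟨
      g c + total g (graft s a t)     ∎
    where
    open ≡-Reasoning
    lemma : ∀ x y z → x + (y + z) ≡ y + (x + z)
    lemma = solve-∀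

  Simple : ∀ {r} → Tree A r → Set
  Simple t = ∀ v → mult t v ≤ 1

  -- Follow the walk: its next vertex is either in the tree already or can be attached as a new
  -- leaf, which keeps the tree simple and loses no vertex.
  reachInto : ∀ {r u v} (t : Tree A r) → Simple t → 1 ≤ mult t u → Reach A u v →
              Σ (Tree A r) λ t′ → Simple t′ × 1 ≤ mult t′ v × (∀ x → mult t x ≤ mult t′ x)
  reachInto t simple u∈t here = t , simple , u∈t , λ x → ≤-refl
  reachInto {r} t simple u∈t (step {j = j} e p) with 1 ℕ.≤? mult t j
  ... | yes j∈t = reachInto t simple j∈t p
  ... | no j∉t with t₁ , eq ← attach t u∈t e =
    let t′ , simple′ , v∈t′ , t₁≤t′ = reachInto t₁ simple₁ j∈t₁ p
    in t′ , simple′ , v∈t′ , λ x → ≤-trans (≤-trans (m≤n+m (mult t x) (δ j x)) (≤-reflexive (sym (eq _))))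
            (t₁≤t′ x)
    where
    simple₁ : Simple t₁
    simple₁ x rewrite eq (λ u → δ u x) with j Finₚ.≟ x
    ... | no _     = simple x
    ... | yes refl = s≤s (ℕ.s≤s⁻¹ (≰⇒> j∉t))
    j∈t₁ : 1 ≤ mult t₁ j
    j∈t₁ rewrite eq (λ u → δ u j) | δ-refl j = s≤s z≤n

  -- The vertices are reached one after another by walks from the root, which every tree contains.
  -- Simplicity turns "at least once" into "exactly once".
  spanning : ∀ {r} → (∀ v → Reach A r v) → Σ (Tree A r) λ t → ∀ v → mult t v ≡ 1
  spanning {r} reach = let t , simple , covers = go m id in t , λ v → ≤-antisym (simple v) (covers v)
    where
    root : (t : Tree A r) → 1 ≤ mult t r
    root t rewrite δ-refl r = s≤s z≤n
    go : ∀ k (ρ : Fin k → Fin m) → Σ (Tree A r) λ t → Simple t × ∀ i → 1 ≤ mult t (ρ i)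
    go zero ρ = leaf r , (λ v → subst (_≤ 1) (sym (+-identityʳ _)) (ι≤1 _)) , λ ()
    go (suc k) ρ with t , simple , covers ← go k (ρ ∘ suc)
                 with t′ , simple′ , last , mono ← reachInto t simple (root t) (reach (ρ zero))
      = t′ , simple′ , λ { zero → last ; (suc i) → ≤-trans (covers i) (mono (ρ (suc i))) }

-- Cutting a tree into light pieces.

module Cutting {A : EdgeSet m} (f : Fin m → ℕ) (g : ℕ)
  (light : ∀ {r} (t : Tree A r) → Simple t → edges t ≤ g → total f t ≤ g) where

  -- Passing from a tree of weight φ with σ vertices to one of weight φ′ with σ′ vertices
  -- removes weight at most 2g/(g+1) per vertex removed.
  Cheap : ℕ → ℕ → ℕ → ℕ → Set
  Cheap φ σ φ′ σ′ = suc g * φ + (g + g) * σ′ ≤ (g + g) * σ + suc g * φ′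

  cheap-refl : ∀ φ σ → Cheap φ σ φ σ
  cheap-refl φ σ = ≤-reflexive (+-comm (suc g * φ) _)

  cheap-+ : ∀ {a b c d a′ b′ c′ d′} → Cheap a b c d → Cheap a′ b′ c′ d′ →
            Cheap (a + a′) (b + b′) (c + c′) (d + d′)
  cheap-+ {a} {b} {c} {d} {a′} {b′} {c′} {d′} p q =
    subst₂ _≤_ (lemma (suc g) (g + g) a d a′ d′) (lemma (g + g) (suc g) b c b′ c′) (+-mono-≤ p q)
    where
    lemma : ∀ x y a d a′ d′ → (x * a + y * d) + (x * a′ + y * d′) ≡ x * (a + a′) + y * (d + d′)
    lemma = solve-∀

  cheap-trans : ∀ {a b c d e h} → Cheap a b c d → Cheap c d e h → Cheap a b e h
  cheap-trans {a} {b} {c} {d} {e} {h} p q = +-cancelʳ-≤ ((g + g) * d + suc g * c) _ _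
    (subst₂ _≤_ (left (suc g * a) ((g + g) * d) (suc g * c) ((g + g) * h))
                (right ((g + g) * b) (suc g * c) ((g + g) * d) (suc g * e)) (+-mono-≤ p q))
    where
    left : ∀ A D C H → (A + D) + (C + H) ≡ (A + H) + (D + C)
    left = solve-∀
    right : ∀ B C D E → (B + C) + (D + E) ≡ (B + E) + (D + C)
    right = solve-∀

  -- The piece has 2σ ≥ g + 1 and φ ≤ g; multiplying gives (g + 1)φ ≤ 2gσ.
  cheap-cut : ∀ {φ σ} → φ ≤ g → g < σ + σ → Cheap φ σ 0 0
  cheap-cut {φ} {σ} φ≤g g<2σ = begin
    suc g * φ + (g + g) * 0   ≡⟨ trans (cong (λ x → suc g * φ + x) (*-zeroʳ (g + g))) (+-identityʳ _) ⟩
    suc g * φ                 ≤⟨ *-mono-≤ g<2σ φ≤g ⟩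
    (σ + σ) * g               ≡⟨ lemma σ g ⟩
    (g + g) * σ               ≤⟨ m≤m+n _ _ ⟩
    (g + g) * σ + suc g * 0   ∎
    where
    open ≤-Reasoning
    lemma : ∀ x y → (x + x) * y ≡ (y + y) * x
    lemma = solve-∀

  -- The part of `t` that stays at the root after the cuts. The root is left out of `small` and
  -- `cheap`: it is counted one level up, together with the edge to its parent.
  record Pruned {r} (t : Tree A r) : Set where
    constructor pruned
    field
      tree  : Tree A r
      mult≤ : ∀ v → mult tree v ≤ mult t v
      small : edges tree + edges tree ≤ g
      cheap : Cheap (belowRoot f t) (edges t) (belowRoot f tree) (edges tree)
  open Pruned

  prune : ∀ {r} (t : Tree A r) → Simple t → Pruned t
  prune (leaf r) _ = pruned (leaf r) (λ v → ≤-refl) z≤n (cheap-refl 0 0)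
  prune {r} (graft {c = c} s e t) simple
    with mult-graft ← (λ v → total-graft (λ u → δ u v) s e t)
    with s-simple ← (λ v → ≤-trans (≤-trans (m≤m+n (mult s v) (mult t v)) (≤-reflexive (sym (mult-graft v))))
        (simple v))
    with t-simple ← (λ v → ≤-trans (≤-trans (m≤n+m (mult t v) (mult s v)) (≤-reflexive (sym (mult-graft v))))
        (simple v))
    with prune s s-simple | prune t t-simple
  ... | pruned s′ s′≤s s′-small s-cheap | pruned t′ t′≤t t′-small t-cheap
    -- The child `c` now counts on both sides, as one more vertex of weight `f c`.
    with t-cheap⁺ ← cheap-+ {f c} {1} {f c} {1} (cheap-refl (f c) 1) t-cheap
    with suc (edges t′) + suc (edges t′) ℕ.≤? g
  -- The remainder at `c`, now including `c`, has more than g/2 vertices, so it is cut off; it has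
  -- at most g edges and is therefore light.
  ... | no t′-big = pruned s′
          (λ v → ≤-trans (s′≤s v) (≤-trans (m≤m+n _ (mult t v)) (≤-reflexive (sym (mult-graft v)))))
          s′-small
          (subst₂ (Cheap _ _) (+-identityʳ _) (+-identityʳ _)
            (cheap-+ {belowRoot f s} s-cheap (cheap-trans {f c + belowRoot f t} t-cheap⁺
              (cheap-cut (light t′ (λ v → ≤-trans (t′≤t v) (t-simple v)) (≤-trans (m≤m+n _ _) t′-small))
                  (≰⇒> t′-big)))))
  ... | yes t′-small⁺ = next
    where
    u : Tree A r
    u = graft s′ e t′
    u≤ : ∀ v → mult u v ≤ mult (graft s e t) v
    u≤ v = subst₂ _≤_ (sym (total-graft (λ x → δ x v) s′ e t′)) (sym (mult-graft v))
        (+-mono-≤ (s′≤s v) (t′≤t v))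
    u-cheap : Cheap (belowRoot f (graft s e t)) (edges (graft s e t)) (belowRoot f u) (edges u)
    u-cheap = cheap-+ {belowRoot f s} s-cheap t-cheap⁺
    -- Both joined parts have at most g/2 edges below the root, the edge to `c` included, so `light`
    -- still applies to `u`.
    u≤g : edges u ≤ g
    u≤g = double-cancel-≤ (subst (_≤ g + g) (lemma (edges s′) (suc (edges t′))) (+-mono-≤ s′-small t′-small⁺))
      where
      lemma : ∀ x y → x + x + (y + y) ≡ x + y + (x + y)
      lemma = solve-∀
    next : Pruned (graft s e t)
    next with edges u + edges u ℕ.≤? g
    ... | yes u-small = pruned u u≤ u-small u-cheap
    -- Everything below the root is cut as one piece. The root remains, so its own weight is only
    -- used as slack in the bound from `light`.
    ... | no u-big = pruned (leaf r)
          (λ v → +-monoʳ-≤ (δ r v) z≤n) z≤n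
          (cheap-trans {belowRoot f (graft s e t)} u-cheap
            (cheap-cut (≤-trans (m≤n+m _ (f r)) (light u (λ v → ≤-trans (u≤ v) (simple v)) u≤g)) (≰⇒> u-big)))

  -- The cut pieces cost at most 2g/(g + 1) per vertex, and the remainder at the root is itself
  -- light, which adds one last g.
  total-bound : ∀ {r} (t : Tree A r) → Simple t →
                suc g * total f t ≤ (g + g) * suc (edges t) + suc g * g
  total-bound {r} t simple with pruned t′ t′≤t t′-small t-cheap ← prune t simple = begin
    suc g * total f t                                    ≤⟨ m≤m+n _ _ ⟩
    suc g * total f t + (g + g) * suc (edges t′)
      ≤⟨ cheap-+ {f r} {1} {f r} {1} (cheap-refl (f r) 1) t-cheap ⟩
    (g + g) * suc (edges t) + suc g * total f t′
      ≤⟨ +-monoʳ-≤ ((g + g) * suc (edges t)) (*-monoʳ-≤ (suc g)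
           (light t′ (λ v → ≤-trans (t′≤t v) (simple v)) (≤-trans (m≤m+n _ _) t′-small))) ⟩
    (g + g) * suc (edges t) + suc g * g                  ∎
    where open ≤-Reasoning

∧-true : ∀ {a b} → a ∧ b ≡ true → a ≡ true × b ≡ true
∧-true {true} {true} _ = refl , refl

true∧ : ∀ {a b} → a ≡ true → b ≡ true → a ∧ b ≡ true
true∧ refl refl = refl

<⇒<ᵇ≡true : ∀ {a b} → a < b → (a <ᵇ b) ≡ true
<⇒<ᵇ≡true {a} {b} a<b with a <ᵇ b | <⇒<ᵇ a<b
... | true | _ = refl

<ᵇ≡true⇒< : ∀ {a b} → (a <ᵇ b) ≡ true → a < b
<ᵇ≡true⇒< {a} {b} e = <ᵇ⇒< a b (subst T (sym e) _)

if-<-if : ∀ a b {x} → (if a then x else 0) < (if b then x else 0) → a ≡ false × b ≡ true × 0 < x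
if-<-if false true  p = refl , refl , p
if-<-if true  true  p = contradiction p (<-irrefl refl)

*-<⇒1≤ : ∀ a {x y} → a * x < a * y → 1 ≤ a
*-<⇒1≤ (suc a) _ = s≤s z≤n

-- Dense graphs: every k is forcing

module Growing (G : Graph) (w : Weighing G) where

  -- A connected edge set with a marked vertex, which makes sense for the empty set too. Reaching
  -- the first end of each edge suffices, since the edge leads on to the second.
  record Rooted (r : Fin (n G)) : Set where
    field
      set   : EdgeSet (n G)
      ⊑E    : set ⊑ E G
      reach : ∀ {u v} → set u v ≡ true → Reach (symClosure set) r u
  open Rooted public

  _∋_ : ∀ {r} → Rooted r → Fin (n G) → Set
  _∋_ {r} X v = Reach (symClosure (set X)) r v

  _⊑ᴿ_ : ∀ {r} → Rooted r → Rooted r → Set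
  X ⊑ᴿ Y = set X ⊑ set Y

  ∋-mono : ∀ {r v} (X Y : Rooted r) → X ⊑ᴿ Y → X ∋ v → Y ∋ v
  ∋-mono X Y X⊑Y = Reach-mono (symClosure-mono {S = set X} {S′ = set Y} X⊑Y)

  ∋-step : ∀ {r u v} (X : Rooted r) → X ∋ u → symClosure (set X) u v ≡ true → X ∋ v
  ∋-step X p e = Reach-trans p (step e here)

  empty : ∀ r → Rooted r
  empty r = record { set = λ _ _ → false ; ⊑E = λ _ _ () ; reach = λ () }

  isEdgeSet : ∀ {r} (X : Rooted r) → IsEdgeSet G (set X)
  isEdgeSet X i j e = ∧-true (⊑E X i j e)

  connectedSub : ∀ {r} (X : Rooted r) → ConnectedSub G (set X)
  connectedSub {r} X u v u∈ v∈ = Reach-trans (Reach-sym (symClosure-sym (set X)) (from u∈)) (from v∈)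
    where
    from : ∀ {u} → Incident G (set X) u → X ∋ u
    from (x , inj₁ e) = ∋-step X (reach X e) (symClosure-fwd (set X) e)
    from (x , inj₂ e) = reach X e

  Extension : ∀ {r} → Rooted r → Fin (n G) → Fin (n G) → Set
  Extension {r} X a b = Σ (Rooted r) λ Y → (X ⊑ᴿ Y) × (Y ∋ a) × (Y ∋ b) ×
    (∀ u → count u (set Y) ≡ count u (set X) + u a b)

  extend : ∀ {r a b} (X : Rooted r) → E G a b ≡ true → set X a b ≡ false → X ∋ a ⊎ X ∋ b → Extension X a b
  extend {r} {a} {b} X Eab Xab end = Y , X⊑Y , proj₁ ends , proj₂ ends ,
    λ u → count-insertEdge u a b (set X) Xab
    where
    S : EdgeSet (n G)
    S = insertEdge a b (set X)
    X⊑Y : set X ⊑ S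
    X⊑Y = insertEdge-⊒ a b (set X)
    lift : ∀ {v} → X ∋ v → Reach (symClosure S) r v
    lift = Reach-mono (symClosure-mono {S = set X} {S′ = S} X⊑Y)
    endsOf : X ∋ a ⊎ X ∋ b → Reach (symClosure S) r a × Reach (symClosure S) r b
    endsOf (inj₁ p) = lift p , Reach-trans (lift p) (step (symClosure-fwd S (insertEdge-∈ a b (set X))) here)
    endsOf (inj₂ p) = Reach-trans (lift p) (step (symClosure-bwd S (insertEdge-∈ a b (set X))) here) , lift p
    ends = endsOf end
    Y : Rooted r
    Y = record
      { set = S
      ; ⊑E = λ i j e → case insertEdge-inv a b (set X) e of λ
          { (inj₁ p) → ⊑E X i j p ; (inj₂ (refl , refl)) → Eab }
      ; reach = λ e → case insertEdge-inv a b (set X) e of λ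
          { (inj₁ p) → lift (reach X p) ; (inj₂ (refl , refl)) → proj₁ ends }
      }

  -- The alternative is whether the edge, not the vertex `v`, is present: an absent edge is added
  -- even if `v` was reached before, so the size grows by exactly one.
  addAdjacent : ∀ {r u v} (X : Rooted r) → X ∋ u → adj G u v ≡ true →
                X ∋ v ⊎ Σ (Rooted r) λ Y → (X ⊑ᴿ Y) × (Y ∋ v) × size (set Y) ≡ suc (size (set X))
  addAdjacent {u = u} {v} X u∈X uv with <-cmp (toℕ u) (toℕ v)
  ... | tri< u<v _ _ with set X u v in Xuv
  ...   | true  = inj₁ (∋-step X u∈X (symClosure-fwd (set X) Xuv))
  ...   | false = let Y , X⊑Y , _ , v∈Y , eq = extend X (true∧ (<⇒<ᵇ≡true u<v) uv) Xuv (inj₁ u∈X)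
                  in inj₂ (Y , X⊑Y , v∈Y , trans (eq (λ _ _ → 1)) (+-comm _ 1))
  addAdjacent {u = u} {v} X u∈X uv | tri≈ _ u≡v _
    with refl ← Finₚ.toℕ-injective u≡v = contradiction (trans (sym uv) (irrefl G u)) λ ()
  addAdjacent {u = u} {v} X u∈X uv | tri> _ _ v<u with set X v u in Xvu
  ...   | true  = inj₁ (∋-step X u∈X (symClosure-bwd (set X) Xvu))
  ...   | false = let vu = true∧ (<⇒<ᵇ≡true v<u) (trans (adj-sym G v u) uv)
                      Y , X⊑Y , v∈Y , _ , eq = extend X vu Xvu (inj₂ u∈X)
                  in inj₂ (Y , X⊑Y , v∈Y , trans (eq (λ _ _ → 1)) (+-comm _ 1))

  include : ∀ {r u v} (X : Rooted r) → X ∋ u → adj G u v ≡ true →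
            Σ (Rooted r) λ Y → (X ⊑ᴿ Y) × (Y ∋ v) × size (set Y) ≤ suc (size (set X))
  include X u∈X e with addAdjacent X u∈X e
  ... | inj₁ v∈X                 = X , (λ _ _ p → p) , v∈X , n≤1+n _
  ... | inj₂ (Y , X⊑Y , v∈Y , eq) = Y , X⊑Y , v∈Y , ≤-reflexive eq

  addTree : ∀ {r c} (X : Rooted r) (t : Tree (adj G) c) → X ∋ c →
            Σ (Rooted r) λ Y → (X ⊑ᴿ Y) × size (set Y) ≤ size (set X) + edges t ×
              (∀ v → 1 ≤ mult t v → Y ∋ v)
  addTree X (leaf c) c∈X = X , (λ _ _ e → e) , m≤m+n _ 0 ,
    λ v p → subst (X ∋_) (δ≥1⇒≡ c v (subst (1 ≤_) (+-identityʳ _) p)) c∈X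
  addTree {c = c} X (graft {c = d} s e t) c∈X
    with X₁ , X⊑X₁ , size₁ , s∈ ← addTree X s c∈X
    with X₂ , X₁⊑X₂ , d∈X₂ , size₂ ← include X₁ (∋-mono X X₁ X⊑X₁ c∈X) e
    with X₃ , X₂⊑X₃ , size₃ , t∈ ← addTree X₂ t d∈X₂
    = X₃ , (λ i j → X₂⊑X₃ i j ∘ X₁⊑X₂ i j ∘ X⊑X₁ i j)
    , ≤-trans size₃ (≤-trans (+-monoˡ-≤ (edges t) (≤-trans size₂ (s≤s size₁)))
        (≤-reflexive (lemma (size (set X)) (edges s) (edges t))))
    , λ v p → case 1≤+⇒1≤⊎1≤ (mult s v) (mult t v) (subst (1 ≤_) (total-graft (λ u → δ u v) s e t) p) of λ
        { (inj₁ q) → ∋-mono X₂ X₃ X₂⊑X₃ (∋-mono X₁ X₂ X₁⊑X₂ (s∈ v q)) ; (inj₂ q) → t∈ v q }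
    where
    lemma : ∀ x y z → suc (x + y) + z ≡ x + (y + suc z)
    lemma = solve-∀

  -- While fewer than `h` negative edges are present, some negative edge assigned to a vertex of `t`
  -- is absent. Its smaller end is in `X`, so adding it keeps the set connected.
  addNegatives : ∀ {r c} (X : Rooted r) (t : Tree (adj G) c) → Simple t → (∀ v → 1 ≤ mult t v → X ∋ v) →
                 ∀ d h → negs w (set X) + d ≡ h → h ≤ total (lowerNegs w (E G)) t →
                 Σ (Rooted r) λ Y → negs w (set Y) ≡ h × size (set Y) ≡ size (set X) + d
  addNegatives X t simple t∈X zero h eq h≤ = X , trans (sym (+-identityʳ _)) eq , sym (+-identityʳ _)
  addNegatives X t simple t∈X (suc d) h eq h≤
    with i , i< ← Σ-<⇒∃
        -- Since `t` is simple, the left sum is at most the number of negative edges of `X`, which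
        -- is below `h`.
        {f = λ v → mult t v * lowerNegs w (set X) v} {g = λ v → mult t v * lowerNegs w (E G) v}
            (let open ≤-Reasoning in begin-strict
        ΣFinℕ (n G) (λ v → mult t v * lowerNegs w (set X) v)
          ≤⟨ Σ-mono (λ v → ≤-trans (*-monoˡ-≤ _ (simple v)) (≤-reflexive (+-identityʳ _))) ⟩
        negs w (set X) <⟨ m<m+n _ (s≤s z≤n) ⟩
        negs w (set X) + suc d ≡⟨ eq ⟩
        h ≤⟨ h≤ ⟩
        total (lowerNegs w (E G)) t ≡⟨ total≡Σmult (lowerNegs w (E G)) t ⟩
        ΣFinℕ (n G) (λ v → mult t v * lowerNegs w (E G) v) ∎)
    with j , j< ← Σ-<⇒∃ (*-cancelˡ-< (mult t i) _ _ i<)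
    with Xij , Eij , ν>0 ← if-<-if (set X i j) (E G i j) j<
    with Y , X⊑Y , _ , _ , count≡ ← extend X Eij Xij (inj₁ (t∈X i (*-<⇒1≤ (mult t i) i<)))
    with Z , negs≡ , size≡ ← addNegatives Y t simple (λ v p → ∋-mono X Y X⊑Y (t∈X v p)) d h
           (trans (cong (_+ d)
               (trans (count≡ (negativity w)) (cong (λ x → negs w (set X) + x) (≤-antisym (ι≤1 _) ν>0))))
               (trans (+-assoc _ 1 d) eq)) h≤
    = Z , negs≡ , trans size≡ (trans (cong (_+ d) (count≡ (λ _ _ → 1))) (+-assoc _ 1 d))

  -- Take a missing edge of `G` and walk to it from the root. The first absent edge on the walk is
  -- added; if there is none, the missing edge itself touches `X`.
  addAny : ∀ {r} (X : Rooted r) → (∀ u v → Reach (adj G) u v) → size (set X) < numEdges G →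
           Σ (Rooted r) λ Y → (X ⊑ᴿ Y) × size (set Y) ≡ suc (size (set X))
  addAny {r} X conn lt
    with i , i< ← Σ-<⇒∃ lt
    with j , j< ← Σ-<⇒∃ i<
    with Xij , Eij , _ ← if-<-if (set X i j) (E G i j) j<
    = walk (conn r i) here
    where
    walk : ∀ {u} → Reach (adj G) u i → X ∋ u → Σ (Rooted r) λ Y → (X ⊑ᴿ Y) × size (set Y) ≡ suc (size (set X))
    walk here i∈X = let Y , X⊑Y , _ , _ , count≡ = extend X Eij Xij (inj₁ i∈X)
                    in Y , X⊑Y , trans (count≡ (λ _ _ → 1)) (+-comm _ 1)
    walk (step e p) u∈X with addAdjacent X u∈X e
    ... | inj₁ v∈X               = walk p v∈X
    ... | inj₂ (Y , X⊑Y , _ , eq) = Y , X⊑Y , eq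

  addMany : ∀ {r} (X : Rooted r) → (∀ u v → Reach (adj G) u v) → ∀ d k → size (set X) + d ≡ k →
      k ≤ numEdges G →
            Σ (Rooted r) λ Y → (X ⊑ᴿ Y) × size (set Y) ≡ k
  addMany X conn zero    k eq k≤ = X , (λ _ _ e → e) , trans (sym (+-identityʳ _)) eq
  addMany X conn (suc d) k eq k≤
    with Y , X⊑Y , size≡ ← addAny X conn (≤-trans (m<m+n _ (s≤s z≤n)) (≤-trans (≤-reflexive eq) k≤))
    with Z , Y⊑Z , sizeZ ← addMany Y conn d k (trans (cong (_+ d) size≡) (trans (sym (+-suc _ d)) eq)) k≤
    = Z , (λ i j → Y⊑Z i j ∘ X⊑Y i j) , sizeZ

  -- With h = g + 1 the hypotheses say k = 2h - 1 or k = 2h. A heavy tree has at most g edges; with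
  -- at most h further ones it has h negative edges and at most 2h - 1 ≤ k edges. Filling up to `k`
  -- edges leaves a connected set in which at least half are negative.
  light : ∀ {k} g → (∀ u v → Reach (adj G) u v) → k ≤ numEdges G → suc (g + g) ≤ k → k ≤ suc g + suc g →
          LocalPos k G w → ∀ {c} (t : Tree (adj G) c) → Simple t → edges t ≤ g →
          total (lowerNegs w (E G)) t ≤ g
  light {k} g conn k≤e lo hi local {c} t simple t≤g = ≮⇒≥ λ heavy →
    let X , _ , sizeX , t∈X = addTree (empty c) t here
        X≤g : size (set X) ≤ g
        X≤g = ≤-trans sizeX
            (≤-trans (+-monoˡ-≤ (edges t) (≤-reflexive (Σ-zero {n G} λ i → Σ-zero {n G} λ j → refl))) t≤g)
        -- This makes the truncated difference in the next step exact.
        negs≤ : negs w (set X) ≤ suc g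
        negs≤ = ≤-trans (count-weight-≤ {v = λ _ _ → 1} (set X) (λ i j → ι≤1 _)) (≤-trans X≤g (n≤1+n g))
        Y , negsY , sizeY = addNegatives X t simple t∈X (suc g ∸ negs w (set X)) (suc g)
            (m+[n∸m]≡n negs≤) heavy
        Y≤k : size (set Y) ≤ k
        Y≤k = begin
          size (set Y)                                 ≡⟨ sizeY ⟩
          size (set X) + (suc g ∸ negs w (set X))      ≤⟨ +-mono-≤ X≤g (m∸n≤m (suc g) (negs w (set X))) ⟩
          g + suc g                                    ≡⟨ +-suc g g ⟩
          suc (g + g)                                  ≤⟨ lo ⟩
          k                                            ∎
        Z , Y⊑Z , sizeZ = addMany Y conn (k ∸ size (set Y)) k (m+[n∸m]≡n Y≤k) k≤e
        negsZ : suc g ≤ negs w (set Z)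
        negsZ = ≤-trans (≤-reflexive (sym negsY)) (count-mono {u = negativity w} {S = set Y} {S′ = set Z} Y⊑Z)
    in <⇒≱ (wt>0⇒2negs<size G w (set Z) (local (set Z) (isEdgeSet Z) sizeZ (connectedSub Z)))
           (≤-trans (≤-reflexive sizeZ) (≤-trans hi (+-mono-≤ negsZ negsZ)))
    where open ≤-Reasoning

-- Forcing for connected graphs with at least 4n edges.

halving : ∀ k → 1 ≤ k → ∃[ g ] (suc (g + g) ≤ k × k ≤ suc g + suc g)
halving 1 _ = 0 , ≤-refl , n≤1+n 1
halving 2 _ = 0 , n≤1+n 1 , ≤-refl
halving (suc (suc (suc k))) _ with g , lo , hi ← halving (suc k) (s≤s z≤n) =
  suc g , s≤s (subst (_≤ suc (suc k)) (cong suc (sym (+-suc g g))) (s≤s lo))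
        , subst (λ x → suc (suc (suc k)) ≤ suc x) (sym (+-suc (suc g) (suc g))) (s≤s (s≤s hi))

-- If w(G) ≤ 0, at least 2n edges are negative, and the cutting bound on a spanning tree gives 2n(g
-- + 1) ≤ 2gn + (g + 1)g, so 2n ≤ (g + 1)g. This fails once n ≥ (g + 1)².
forcing-of-dense : ∀ k → 1 ≤ k → ∃[ N ] ∀ (G : Graph) → Connected G → 4 * n G ≤ numEdges G → N ≤ n G →
                   ∀ (w : Weighing G) → LocalPos k G w → + 0 ℤ.< wt G w (E G)
forcing-of-dense k 1≤k with g , lo , hi ← halving k 1≤k = suc g * suc g , main
  where
  main : ∀ (G : Graph) → Connected G → 4 * n G ≤ numEdges G → suc g * suc g ≤ n G →
         ∀ (w : Weighing G) → LocalPos k G w → + 0 ℤ.< wt G w (E G)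
  main G (0<n , conn) dense N≤n w local = 2negs<size⇒wt>0 G w (E G) (≰⇒> λ e≤2negs →
    let 2n≤negs : n G + n G ≤ negs w (E G)
        2n≤negs = double-cancel-≤ (≤-trans (≤-reflexive (four (n G))) (≤-trans dense e≤2negs))
        t , once = spanning {A = adj G} {r = r} (conn r)
        simple : Simple t
        simple v = ≤-reflexive (once v)
        total≡ : ∀ f → total f t ≡ ΣFinℕ (n G) f
        total≡ f = trans (total≡Σmult f t) (Σ-cong λ v → trans (cong (_* f v) (once v)) (+-identityʳ (f v)))
        edges≡ : suc (edges t) ≡ n G
        edges≡ = trans (total≡ (λ _ → 1)) (Σ-one (n G))
        bound : suc g * negs w (E G) ≤ (g + g) * n G + suc g * g
        bound = subst₂ (λ x y → suc g * x ≤ (g + g) * y + suc g * g) (total≡ (lowerNegs w (E G))) edges≡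
                  (Cutting.total-bound (lowerNegs w (E G)) g (light g conn k≤e lo hi local) t simple)
        2n≤ : n G + n G ≤ suc g * g
        2n≤ = +-cancelˡ-≤ ((g + g) * n G) _ _ (≤-trans (≤-reflexive (expand g (n G)))
                (≤-trans (*-monoʳ-≤ (suc g) 2n≤negs) bound))
    in <⇒≱ (≤-<-trans 2n≤ (*-monoʳ-< (suc g) (n<1+n g))) (≤-trans N≤n (m≤m+n (n G) (n G))))
    where
    open Growing G w
    r : Fin (n G)
    r = fromℕ< 0<n
    four : ∀ x → (x + x) + (x + x) ≡ 4 * x
    four = solve-∀
    expand : ∀ g x → (g + g) * x + (x + x) ≡ suc g * (x + x)
    expand = solve-∀
    k≤e : k ≤ numEdges G
    k≤e = begin
      k                     ≤⟨ hi ⟩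
      suc g + suc g         ≤⟨ +-mono-≤ (m≤m*n (suc g) (suc g)) (m≤m*n (suc g) (suc g)) ⟩
      suc g * suc g + suc g * suc g ≤⟨ +-mono-≤ N≤n N≤n ⟩
      n G + n G             ≤⟨ m≤m+n _ _ ⟩
      (n G + n G) + (n G + n G) ≡⟨ four (n G) ⟩
      4 * n G               ≤⟨ dense ⟩
      numEdges G            ∎
      where open ≤-Reasoning

-- Boolean comparisons and sums for the construction.

≥⇒<ᵇ≡false : ∀ {a b} → b ≤ a → (a <ᵇ b) ≡ false
≥⇒<ᵇ≡false {a} {b} b≤a with a <ᵇ b in eq
... | false = refl
... | true  = contradiction (<ᵇ≡true⇒< eq) (≤⇒≯ b≤a)

<ᵇ≡false⇒≥ : ∀ {a b} → (a <ᵇ b) ≡ false → b ≤ a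
<ᵇ≡false⇒≥ {a} {b} e = ≮⇒≥ λ a<b → contradiction (trans (sym (<⇒<ᵇ≡true a<b)) e) λ ()

≡ᵇ≡true⇒≡ : ∀ {a b} → (a ≡ᵇ b) ≡ true → a ≡ b
≡ᵇ≡true⇒≡ {a} {b} e = ≡ᵇ⇒≡ a b (subst T (sym e) _)

≡ᵇ-refl : ∀ a → (a ≡ᵇ a) ≡ true
≡ᵇ-refl zero    = refl
≡ᵇ-refl (suc a) = ≡ᵇ-refl a

Σ-splitℕ : ∀ a b (h : ℕ → ℕ) → ΣFinℕ (a + b) (λ i → h (toℕ i)) ≡
           ΣFinℕ a (λ i → h (toℕ i)) + ΣFinℕ b (λ i → h (a + toℕ i))
Σ-splitℕ zero    b h = refl
Σ-splitℕ (suc a) b h = trans (cong (λ s → h 0 + s) (Σ-splitℕ a b (h ∘ suc))) (sym (+-assoc (h 0) _ _))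

Σ-≡ᵇ : ∀ {n} a → a < n → ΣFinℕ n (λ i → ι (toℕ i ≡ᵇ a)) ≡ 1
Σ-≡ᵇ {suc n} zero    _   = cong suc (Σ-zero {n} λ i → refl)
Σ-≡ᵇ {suc n} (suc a) a<n = Σ-≡ᵇ {n} a (ℕ.s<s⁻¹ a<n)

Σ-pair : {i j : Fin m} (h : Fin m → ℕ) → i ≢ j → h i + h j ≤ ΣFinℕ m h
Σ-pair {m} {i} {j} h i≢j = begin
  h i + h j ≡⟨ cong₂ _+_ (Σ-δ i h) (Σ-δ j h) ⟨
  ΣFinℕ m (λ x → δ i x * h x) + ΣFinℕ m (λ x → δ j x * h x)
    ≡⟨ Σ-distrib-+ (λ x → δ i x * h x) (λ x → δ j x * h x) ⟨
  ΣFinℕ m (λ x → δ i x * h x + δ j x * h x) ≤⟨ Σ-mono pointwise ⟩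
  ΣFinℕ m h ∎
  where
  open ≤-Reasoning
  pointwise : ∀ x → δ i x * h x + δ j x * h x ≤ h x
  pointwise x with i Finₚ.≟ x | j Finₚ.≟ x
  ... | yes refl | yes refl = contradiction refl i≢j
  ... | yes _    | no _     = ≤-reflexive (trans (+-identityʳ _) (+-identityʳ _))
  ... | no _     | yes _    = ≤-reflexive (+-identityʳ _)
  ... | no _     | no _     = z≤n

count-split : ∀ {n} {u v : Fin n → Fin n → ℕ} S → (∀ i j → u i j + v i j ≡ 1) → count u S + count v S ≡ size S
count-split {n} {u} {v} S u+v = begin
  count u S + count v S
    ≡⟨ Σ-distrib-+ (λ i → ΣFinℕ n (μ i)) (λ i → ΣFinℕ n (κ i)) ⟨
  ΣFinℕ n (λ i → ΣFinℕ n (μ i) + ΣFinℕ n (κ i))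
    ≡⟨ (Σ-cong λ i → trans (sym (Σ-distrib-+ (μ i) (κ i))) (Σ-cong (pointwise i))) ⟩
  size S ∎
  where
  open ≡-Reasoning
  μ κ : Fin n → Fin n → ℕ
  μ i j = if S i j then u i j else 0
  κ i j = if S i j then v i j else 0
  pointwise : ∀ i j → μ i j + κ i j ≡ (if S i j then 1 else 0)
  pointwise i j with S i j
  ... | false = refl
  ... | true  = u+v i j

count-cong : ∀ {n} {u : Fin n → Fin n → ℕ} {S S′} → (∀ i j → S i j ≡ S′ i j) → count u S ≡ count u S′
count-cong {u = u} e = Σ-cong λ i → Σ-cong λ j → cong (if_then u i j else 0) (e i j)

-- Sparse graphs: the spider construction

-- M branches hang from a centre 0.  A branch consists of a path (positions p < t) followed by
-- a complete bipartite graph between s vertices (positions t ≤ p < t + s) and a + c further ones;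
-- its negative edges are those to the first a of these.
module Spider (M t s a c : ℕ) (0<s : 0 < s) (0<a : 0 < a) where

  b₀ B : ℕ
  b₀ = t + s
  B = b₀ + (a + c)

  V : Set
  V = Fin (suc (M * B))

  branch : Fin (M * B) → Fin M
  branch i = proj₁ (remQuot B i)

  pos : Fin (M * B) → ℕ
  pos i = toℕ (proj₂ (remQuot {M} B i))

  -- Pairs are oriented towards larger positions. Position t - 1 is joined to `t`, the first left
  -- vertex, which attaches the bipartite blob to the path.
  joined : ℕ → ℕ → Bool
  joined p q = if p <ᵇ t then q ≡ᵇ suc p else (p <ᵇ b₀) ∧ not (q <ᵇ b₀)

  sign : ℕ → ℕ → Sign
  sign p q = if p <ᵇ t then Sign.+ else if q <ᵇ b₀ + a then Sign.- else Sign.+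

  up : EdgeSet (suc (M * B))
  up zero    zero    = false
  up zero    (suc j) = pos j ≡ᵇ 0
  up (suc i) zero    = false
  up (suc i) (suc j) = ⌊ branch i Finₚ.≟ branch j ⌋ ∧ joined (pos i) (pos j)

  weighing : V → V → Sign
  weighing zero    j       = Sign.+
  weighing (suc i) zero    = Sign.+
  weighing (suc i) (suc j) = sign (pos i) (pos j)

  joined⇒< : ∀ p q → joined p q ≡ true → p < q
  joined⇒< p q e with p <ᵇ t
  ... | true = ≤-reflexive (sym (≡ᵇ≡true⇒≡ e))
  ... | false with p <ᵇ b₀ in p<b₀ | q <ᵇ b₀ in q≥b₀
  ...   | true | false = <-≤-trans (<ᵇ≡true⇒< {p} {b₀} p<b₀) (<ᵇ≡false⇒≥ {q} {b₀} q≥b₀)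

  up-inv : ∀ i j → up (suc i) (suc j) ≡ true → branch i ≡ branch j × joined (pos i) (pos j) ≡ true
  up-inv i j e with branch i Finₚ.≟ branch j
  ... | yes p = p , e

  toℕ-vertex : ∀ i → toℕ i ≡ B * toℕ (branch i) + pos i
  toℕ-vertex i = trans (cong toℕ (sym (Finₚ.combine-remQuot {M} B i)))
    (Finₚ.toℕ-combine (branch i) (proj₂ (remQuot {M} B i)))

  up⇒< : ∀ i j → up i j ≡ true → toℕ i < toℕ j
  up⇒< zero    (suc j) e = s≤s z≤n
  up⇒< (suc i) (suc j) e with same , e′ ← up-inv i j e = s≤s (begin-strict
    toℕ i                        ≡⟨ toℕ-vertex i ⟩
    B * toℕ (branch i) + pos i   <⟨ +-monoʳ-< _ (joined⇒< _ _ e′) ⟩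
    B * toℕ (branch i) + pos j   ≡⟨ cong (λ b → B * toℕ b + pos j) same ⟩
    B * toℕ (branch j) + pos j   ≡⟨ toℕ-vertex j ⟨
    toℕ j                        ∎)
    where open ≤-Reasoning

  graph : Graph
  graph = record
    { n      = suc (M * B)
    ; adj    = symClosure up
    ; sym    = symClosure-sym up
    ; irrefl = loopless
    }
    where
    loopless : ∀ i → symClosure up i i ≡ false
    loopless i with up i i in eq
    ... | false = refl
    ... | true  = contradiction (up⇒< i i eq) (<-irrefl refl)

  -- `up` already runs from smaller to larger indices, so symmetrising it and keeping the increasing
  -- pairs gives it back.
  E≡up : ∀ i j → E graph i j ≡ up i j
  E≡up i j with up i j in ij | up j i in ji
  ... | true  | _     = true∧ (<⇒<ᵇ≡true (up⇒< i j ij)) refl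
  ... | false | true  rewrite ≥⇒<ᵇ≡false (<⇒≤ (up⇒< j i ji)) = refl
  ... | false | false with toℕ i <ᵇ toℕ j
  ...   | true  = refl
  ...   | false = refl

  vertex : Fin M → Fin B → V
  vertex b p = suc (combine b p)

  branch-vertex : ∀ b p → branch (combine b p) ≡ b
  branch-vertex b p = cong proj₁ (Finₚ.remQuot-combine b p)

  pos-vertex : ∀ (b : Fin M) p → pos (combine b p) ≡ toℕ p
  pos-vertex b p = cong (λ x → toℕ (proj₂ x)) (Finₚ.remQuot-combine b p)

  joined⇒up : ∀ b {p q} → joined (toℕ p) (toℕ q) ≡ true → up (vertex b p) (vertex b q) ≡ true
  joined⇒up b {p} {q} e
    rewrite branch-vertex b p | branch-vertex b q | pos-vertex b p | pos-vertex b q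
    with b Finₚ.≟ b
  ... | yes _ = e
  ... | no ¬p = contradiction refl ¬p

  t<b₀ : t < b₀
  t<b₀ = m<m+n t 0<s

  b₀<B : b₀ < B
  b₀<B = m<m+n b₀ (≤-trans 0<a (m≤m+n a c))

  joined-path : ∀ {p} → p < t → joined p (suc p) ≡ true
  joined-path {p} p<t rewrite <⇒<ᵇ≡true p<t = ≡ᵇ-refl p

  joined-bipartite : ∀ {p q} → t ≤ p → p < b₀ → b₀ ≤ q → joined p q ≡ true
  joined-bipartite t≤p p<b₀ b₀≤q
    rewrite ≥⇒<ᵇ≡false t≤p | <⇒<ᵇ≡true p<b₀ | ≥⇒<ᵇ≡false b₀≤q = refl

  module _ (b : Fin M) where

    reach-path : ∀ m (p : Fin B) → toℕ p ≡ m → m ≤ t → Reach (adj graph) (vertex b p) zero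
    reach-path zero p eq _ = step
        (symClosure-bwd up {vertex b p} {zero} (trans (cong (_≡ᵇ 0) (trans (pos-vertex b p) eq)) refl)) here
    reach-path (suc m) p eq m<t = step
        (symClosure-bwd up {vertex b p} {vertex b p′}
        (joined⇒up b (subst₂ (λ x y → joined x y ≡ true) (sym p′≡m) (sym eq) (joined-path m<t))))
                                       (reach-path m p′ p′≡m (<⇒≤ m<t))
      where
      m<B : m < B
      m<B = <-trans m<t (<-trans t<b₀ b₀<B)
      p′ : Fin B
      p′ = fromℕ< m<B
      p′≡m : toℕ p′ ≡ m
      p′≡m = Finₚ.toℕ-fromℕ< m<B

    reach-right : ∀ p → b₀ ≤ toℕ p → Reach (adj graph) (vertex b p) zero
    reach-right p b₀≤p = step
        (symClosure-bwd up {vertex b p} {vertex b p′}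
        (joined⇒up b (joined-bipartite (≤-reflexive (sym p′≡t)) (subst (_< b₀) (sym p′≡t) t<b₀) b₀≤p)))
                              (reach-path t p′ p′≡t ≤-refl)
      where
      t<B : t < B
      t<B = <-trans t<b₀ b₀<B
      p′ : Fin B
      p′ = fromℕ< t<B
      p′≡t : toℕ p′ ≡ t
      p′≡t = Finₚ.toℕ-fromℕ< t<B

    reach-left : ∀ p → t ≤ toℕ p → toℕ p < b₀ → Reach (adj graph) (vertex b p) zero
    reach-left p t≤p p<b₀ = step
        (symClosure-fwd up {vertex b p} {vertex b p′} (joined⇒up b (joined-bipartite t≤p p<b₀ b₀≤p′)))
        (reach-right p′ b₀≤p′)
      where
      p′ : Fin B
      p′ = fromℕ< b₀<B
      b₀≤p′ : b₀ ≤ toℕ p′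
      b₀≤p′ = ≤-reflexive (sym (Finₚ.toℕ-fromℕ< b₀<B))

  -- Positions up to `t` descend the path, a right vertex first steps to position `t`, and any other
  -- left vertex first steps to the right vertex `b₀`.
  reach-centre : ∀ v → Reach (adj graph) v zero
  reach-centre zero = here
  reach-centre (suc i) = subst (λ x → Reach (adj graph) (suc x) zero) (Finₚ.combine-remQuot {M} B i)
                           (go (branch i) (proj₂ (remQuot {M} B i)))
    where
    go : ∀ b p → Reach (adj graph) (vertex b p) zero
    go b p with toℕ p ℕ.≤? t | toℕ p ℕ.<? b₀
    ... | yes p≤t | _        = reach-path b (toℕ p) p refl p≤t
    ... | no p≰t  | yes p<b₀ = reach-left b p (<⇒≤ (≰⇒> p≰t)) p<b₀
    ... | no _    | no p≮b₀  = reach-right b p (≮⇒≥ p≮b₀)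

  connected : Connected graph
  connected = s≤s z≤n , λ u v → Reach-trans (reach-centre u) (Reach-sym (symClosure-sym up) (reach-centre v))

  module _ (u : ℕ → ℕ → ℕ) where

    rowSum : ℕ → ℕ
    rowSum p = ΣFinℕ B λ q → if joined p (toℕ q) then u p (toℕ q) else 0

    -- No edge of `up` out of a branch vertex leaves its branch, so only the block of `b`
    -- contributes. Any `u` is allowed, to serve both edge and negative-edge counts.
    Σ-row : (ũ : V → V → ℕ) → (∀ i j → ũ (suc i) (suc j) ≡ u (pos i) (pos j)) → ∀ b p →
            ΣFinℕ (suc (M * B)) (λ j → if up (vertex b p) j then ũ (vertex b p) j else 0) ≡ rowSum (toℕ p)
    Σ-row ũ eq b p = begin
      ΣFinℕ (M * B) (λ j → if up (vertex b p) (suc j) then ũ (vertex b p) (suc j) else 0)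
        ≡⟨ Σ-combine M _ ⟩
      ΣFinℕ M (λ b′ → ΣFinℕ B λ q → if up (vertex b p) (vertex b′ q) then ũ (vertex b p) (vertex b′ q) else 0)
        ≡⟨ (Σ-cong λ b′ → trans (Σ-cong (pointwise b′)) (Σ-scale b′)) ⟩
      ΣFinℕ M (λ b′ → δ b b′ * rowSum (toℕ p))
        ≡⟨ Σ-δ b (λ _ → rowSum (toℕ p)) ⟩
      rowSum (toℕ p) ∎
      where
      open ≡-Reasoning
      entry : Fin B → ℕ
      entry q = if joined (toℕ p) (toℕ q) then u (toℕ p) (toℕ q) else 0
      pointwise : ∀ b′ q →
          (if up (vertex b p) (vertex b′ q) then ũ (vertex b p) (vertex b′ q) else 0) ≡ δ b b′ * entry q
      pointwise b′ q
        rewrite eq (combine b p) (combine b′ q)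
              | branch-vertex b p | branch-vertex b′ q | pos-vertex b p | pos-vertex b′ q
        with b Finₚ.≟ b′
      ... | yes _ = sym (+-identityʳ _)
      ... | no _  = refl
      Σ-scale : ∀ b′ → ΣFinℕ B (λ q → δ b b′ * entry q) ≡ δ b b′ * rowSum (toℕ p)
      Σ-scale b′ with b Finₚ.≟ b′
      ... | yes _ = trans (Σ-cong λ q → +-identityʳ (entry q)) (sym (+-identityʳ _))
      ... | no _  = Σ-zero {B} λ q → refl

    -- A path row holds one edge and a left row the whole bipartite fan; right rows are empty
    -- because of the orientation.
    ΣrowSum : ∀ x y → (∀ p → p < t → u p (suc p) ≡ x) →
              (∀ p → t ≤ p → ΣFinℕ (a + c) (λ q → u p (b₀ + toℕ q)) ≡ y) →
              ΣFinℕ B (λ p → rowSum (toℕ p)) ≡ t * x + s * y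
    ΣrowSum x y path bip = begin
      ΣFinℕ B (λ p → rowSum (toℕ p)) ≡⟨ Σ-splitℕ b₀ (a + c) rowSum ⟩
      ΣFinℕ b₀ (λ p → rowSum (toℕ p)) + ΣFinℕ (a + c) (λ p → rowSum (b₀ + toℕ p))
        ≡⟨ cong₂ _+_ (Σ-splitℕ t s rowSum) (Σ-zero {a + c} (λ i → right (toℕ i))) ⟩
      ΣFinℕ t (λ p → rowSum (toℕ p)) + ΣFinℕ s (λ p → rowSum (t + toℕ p)) + 0
        ≡⟨ +-identityʳ _ ⟩
      ΣFinℕ t (λ p → rowSum (toℕ p)) + ΣFinℕ s (λ p → rowSum (t + toℕ p))
        ≡⟨ cong₂ _+_ (trans (Σ-cong λ p → onPath (toℕ p) (Finₚ.toℕ<n p)) (Σ-const t x))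
                     (trans (Σ-cong λ p → left (toℕ p) (Finₚ.toℕ<n p)) (Σ-const s y)) ⟩
      t * x + s * y ∎
      where
      open ≡-Reasoning
      onPath : ∀ p → p < t → rowSum p ≡ x
      onPath p p<t = begin
        rowSum p ≡⟨ Σ-cong {B} (λ q → pointwise (toℕ q)) ⟩
        ΣFinℕ B (λ q → ι (toℕ q ≡ᵇ suc p) * x) ≡⟨ Σ-cong {B} (λ q → *-comm (ι (toℕ q ≡ᵇ suc p)) x) ⟩
        ΣFinℕ B (λ q → x * ι (toℕ q ≡ᵇ suc p)) ≡⟨ Σ-*ˡ B x _ ⟩
        x * ΣFinℕ B (λ q → ι (toℕ q ≡ᵇ suc p)) ≡⟨ cong (x *_)
            (Σ-≡ᵇ (suc p) (<-trans (s≤s p<t) (<-≤-trans (s≤s t<b₀) b₀<B))) ⟩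
        x * 1 ≡⟨ *-identityʳ x ⟩
        x ∎
        where
        pointwise : ∀ q → (if joined p q then u p q else 0) ≡ ι (q ≡ᵇ suc p) * x
        pointwise q rewrite <⇒<ᵇ≡true p<t with q ≡ᵇ suc p in eq
        ... | false = refl
        ... | true rewrite ≡ᵇ≡true⇒≡ {q} eq = trans (path p p<t) (sym (+-identityʳ x))
        Σ-*ˡ : ∀ n x (h : Fin n → ℕ) → ΣFinℕ n (λ i → x * h i) ≡ x * ΣFinℕ n h
        Σ-*ˡ zero    x h = sym (*-zeroʳ x)
        Σ-*ˡ (suc n) x h = trans (cong (λ z → x * h zero + z) (Σ-*ˡ n x (h ∘ suc)))
            (sym (*-distribˡ-+ x (h zero) _))
      left : ∀ i → i < s → rowSum (t + i) ≡ y
      left i i<s = trans (Σ-splitℕ b₀ (a + c) (λ q → if joined (t + i) q then u (t + i) q else 0))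
        (trans (cong₂ _+_ (Σ-zero λ q → low (toℕ q) (Finₚ.toℕ<n q)) (Σ-cong {a + c} λ q → high (toℕ q)))
            (bip (t + i) (m≤m+n t i)))
        where
        low : ∀ q → q < b₀ → (if joined (t + i) q then u (t + i) q else 0) ≡ 0
        low q q<b₀ rewrite ≥⇒<ᵇ≡false (m≤m+n t i) | <⇒<ᵇ≡true (+-monoʳ-< t i<s) | <⇒<ᵇ≡true q<b₀ = refl
        high : ∀ q → (if joined (t + i) (b₀ + q) then u (t + i) (b₀ + q) else 0) ≡ u (t + i) (b₀ + q)
        high q rewrite joined-bipartite (m≤m+n t i) (+-monoʳ-< t i<s) (m≤m+n b₀ q) = refl
      right : ∀ i → rowSum (b₀ + i) ≡ 0
      right i = Σ-zero {B} λ q → pointwise (toℕ q)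
        where
        pointwise : ∀ q → (if joined (b₀ + i) q then u (b₀ + i) q else 0) ≡ 0
        pointwise q rewrite ≥⇒<ᵇ≡false (≤-trans (<⇒≤ t<b₀) (m≤m+n b₀ i)) | ≥⇒<ᵇ≡false (m≤m+n b₀ i) = refl

  ΣrowNegs : ΣFinℕ B (λ p → rowSum (negativity sign) (toℕ p)) ≡ s * a
  ΣrowNegs = trans (ΣrowSum (negativity sign) 0 a path bip) (cong (_+ s * a) (*-zeroʳ t))
    where
    path : ∀ p → p < t → negativity sign p (suc p) ≡ 0
    path p p<t rewrite <⇒<ᵇ≡true p<t = refl
    bip : ∀ p → t ≤ p → ΣFinℕ (a + c) (λ q → negativity sign p (b₀ + toℕ q)) ≡ a
    bip p t≤p = trans (Σ-splitℕ a c (λ q → negativity sign p (b₀ + q)))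
      (trans (cong₂ _+_ (trans (Σ-cong λ q → low (toℕ q) (Finₚ.toℕ<n q)) (Σ-one a))
          (Σ-zero {c} λ q → high (toℕ q))) (+-identityʳ a))
      where
      low : ∀ q → q < a → negativity sign p (b₀ + q) ≡ 1
      low q q<a rewrite ≥⇒<ᵇ≡false t≤p | <⇒<ᵇ≡true (+-monoʳ-< b₀ q<a) = refl
      high : ∀ q → negativity sign p (b₀ + (a + q)) ≡ 0
      high q rewrite ≥⇒<ᵇ≡false t≤p | ≥⇒<ᵇ≡false (+-monoʳ-≤ b₀ (m≤m+n a q)) = refl

  numEdges-graph : numEdges graph ≡ M * (1 + (t + s * (a + c)))
  numEdges-graph = begin
    size (E graph) ≡⟨ count-cong {u = λ _ _ → 1} {S = E graph} {S′ = up} E≡up ⟩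
    ΣFinℕ (M * B) (λ j → ι (pos j ≡ᵇ 0))
      + ΣFinℕ (M * B) (λ i → ΣFinℕ (suc (M * B)) λ j → if up (suc i) j then 1 else 0)
      ≡⟨ cong₂ _+_ (trans (Σ-combine M (λ j → ι (pos j ≡ᵇ 0))) (trans (Σ-cong λ b → first b) (Σ-const M 1)))
                   (trans (Σ-combine M _)
                       (trans (Σ-cong λ b → trans
                       (Σ-cong (Σ-row (λ _ _ → 1) (λ _ _ → 1) (λ _ _ → refl) b)) inBranch) (Σ-const M _))) ⟩
    M * 1 + M * (t + s * (a + c)) ≡⟨ *-distribˡ-+ M 1 _ ⟨
    M * (1 + (t + s * (a + c))) ∎
    where
    open ≡-Reasoning
    first : (b : Fin M) → ΣFinℕ B (λ p → ι (pos (combine b p) ≡ᵇ 0)) ≡ 1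
    first b = trans (Σ-cong λ p → cong (λ x → ι (x ≡ᵇ 0)) (pos-vertex b p)) (Σ-≡ᵇ 0 (≤-<-trans z≤n b₀<B))
    inBranch : ΣFinℕ B (λ p → rowSum (λ _ _ → 1) (toℕ p)) ≡ t + s * (a + c)
    inBranch = trans (ΣrowSum (λ _ _ → 1) 1 (a + c) (λ _ _ → refl) (λ _ _ → Σ-one (a + c)))
        (cong (_+ s * (a + c)) (*-identityʳ t))

  lowerNegs-vertex : ∀ b p → lowerNegs weighing up (vertex b p) ≡ rowSum (negativity sign) (toℕ p)
  lowerNegs-vertex = Σ-row (negativity sign) (negativity weighing) (λ _ _ → refl)

  lowerNegs-centre : ∀ S → lowerNegs weighing S zero ≡ 0
  lowerNegs-centre S = Σ-zero {suc (M * B)} λ j → pointwise j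
    where
    pointwise : ∀ j → (if S zero j then 0 else 0) ≡ 0
    pointwise j with S zero j
    ... | true  = refl
    ... | false = refl

  negs-graph : negs weighing (E graph) ≡ M * (s * a)
  negs-graph = begin
    negs weighing (E graph) ≡⟨ count-cong {u = negativity weighing} {S = E graph} {S′ = up} E≡up ⟩
    negs weighing up ≡⟨ cong (_+ ΣFinℕ (M * B) (λ i → lowerNegs weighing up (suc i))) (lowerNegs-centre up) ⟩
    ΣFinℕ (M * B) (λ i → lowerNegs weighing up (suc i)) ≡⟨ Σ-combine M _ ⟩
    ΣFinℕ M (λ b → ΣFinℕ B (λ p → lowerNegs weighing up (vertex b p)))
      ≡⟨ (Σ-cong λ b → trans (Σ-cong (lowerNegs-vertex b)) ΣrowNegs) ⟩
    ΣFinℕ M (λ b → s * a) ≡⟨ Σ-const M _ ⟩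
    M * (s * a) ∎
    where open ≡-Reasoning

  -- For p < t this is the side away from the centre of the path edge from `p` to p + 1, the only
  -- edge between this set and its complement.
  beyond : Fin M → ℕ → V → Bool
  beyond b p zero    = false
  beyond b p (suc i) = ⌊ b Finₚ.≟ branch i ⌋ ∧ (p <ᵇ pos i)

  beyond-intro : ∀ {b p} i → b ≡ branch i → p < pos i → beyond b p (suc i) ≡ true
  beyond-intro {b} i refl p< with b Finₚ.≟ b
  ... | yes _ = <⇒<ᵇ≡true p<
  ... | no ¬p = contradiction refl ¬p

  beyond-inv : ∀ {b p} i → beyond b p (suc i) ≡ true → b ≡ branch i × p < pos i
  beyond-inv {b} i e with b Finₚ.≟ branch i
  ... | yes eq = eq , <ᵇ≡true⇒< e

  beyond-other : ∀ {b p} i → b ≢ branch i → beyond b p (suc i) ≡ false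
  beyond-other {b} i b≢ with b Finₚ.≟ branch i
  ... | yes eq = contradiction eq b≢
  ... | no _   = refl

  -- The negative edges of branch `b` alone. Comparing their total `s * a` with the negative edges
  -- of a set detects a second branch.
  within : Fin M → V → ℕ
  within b zero    = 0
  within b (suc i) = δ b (branch i) * lowerNegs weighing up (suc i)

  Σwithin : ∀ b → ΣFinℕ (suc (M * B)) (within b) ≡ s * a
  Σwithin b = begin
    ΣFinℕ (M * B) (λ i → within b (suc i)) ≡⟨ Σ-combine M _ ⟩
    ΣFinℕ M (λ b′ → ΣFinℕ B λ p → within b (vertex b′ p)) ≡⟨ Σ-cong inner ⟩
    ΣFinℕ M (λ b′ → δ b b′ * (s * a)) ≡⟨ Σ-δ b (λ _ → s * a) ⟩
    s * a ∎
    where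
    open ≡-Reasoning
    scale : ∀ b′ → ΣFinℕ B (λ p → δ b b′ * rowSum (negativity sign) (toℕ p)) ≡ δ b b′ * (s * a)
    scale b′ with b Finₚ.≟ b′
    ... | yes _ = trans (Σ-cong {B} λ p → +-identityʳ _) (trans ΣrowNegs (sym (+-identityʳ _)))
    ... | no _  = Σ-zero {B} λ p → refl
    inner : ∀ b′ → ΣFinℕ B (λ p → within b (vertex b′ p)) ≡ δ b b′ * (s * a)
    inner b′ = trans (Σ-cong λ p → cong₂ (λ x y → δ b x * y) (branch-vertex b′ p) (lowerNegs-vertex b′ p))
        (scale b′)

  negative⇒right : ∀ i j → 0 < negativity weighing (suc i) j → t ≤ pos i
  negative⇒right i (suc j) p with pos i <ᵇ t in eq
  ... | false = <ᵇ≡false⇒≥ eq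

  module _ (S : EdgeSet (suc (M * B))) (S⊑up : S ⊑ up) where

    -- Edges lead to larger positions, so one across the cut starts at a position at most `p` and
    -- ends above `p`. It starts on the path, where the only step is to the next position, so it
    -- starts at `p` itself. Centre edges end at position 0 and never cross.
    bridgeAt : ∀ b p → toℕ p < t → ∀ x y → S x y ≡ true ⊎ S y x ≡ true →
               beyond b (toℕ p) x ≡ true → beyond b (toℕ p) y ≡ false → ∃[ j ] S (vertex b p) j ≡ true
    bridgeAt b p p<t (suc i) zero (inj₁ Sij) Xi Xj with () ← S⊑up (suc i) zero Sij
    bridgeAt b p p<t (suc i) (suc j) (inj₁ Sij) Xi Xj
      with same , i~j ← up-inv i j (S⊑up _ _ Sij) | b≡ , p<i ← beyond-inv i Xi =
      contradiction (trans (sym (beyond-intro j (trans b≡ same) (<-trans p<i (joined⇒< _ _ i~j)))) Xj) λ ()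
    bridgeAt b p p<t (suc i) zero (inj₂ Sji) Xi Xj
      with b≡ , p<i ← beyond-inv i Xi =
      contradiction (subst (toℕ p <_) (≡ᵇ≡true⇒≡ (S⊑up zero (suc i) Sji)) p<i) λ ()
    bridgeAt b p p<t (suc i) (suc j) (inj₂ Sji) Xi Xj
      with same , j~i ← up-inv j i (S⊑up _ _ Sji) | b≡ , p<i ← beyond-inv i Xi =
      suc i , subst (λ x → S (suc x) (suc i) ≡ true) j≡ Sji
      where
      b≡j : b ≡ branch j
      b≡j = trans b≡ (sym same)
      j≤p : pos j ≤ toℕ p
      j≤p = ≮⇒≥ λ p<j → contradiction (trans (sym (beyond-intro j b≡j p<j)) Xj) λ ()
      joined-inv : ∀ x y → x < t → joined x y ≡ true → y ≡ suc x
      joined-inv x y x<t e rewrite <⇒<ᵇ≡true x<t = ≡ᵇ≡true⇒≡ e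
      pos≡ : pos j ≡ toℕ p
      pos≡ = ≤-antisym j≤p (ℕ.s≤s⁻¹ (subst (toℕ p <_) (joined-inv _ _ (≤-<-trans j≤p p<t) j~i) p<i))
      j≡ : j ≡ combine b p
      j≡ = trans (sym (Finₚ.combine-remQuot {M} B j)) (cong₂ combine (sym b≡j) (Finₚ.toℕ-injective pos≡))

    bridge : ∀ b p → toℕ p < t → ∀ {u v} → Reach (symClosure S) u v →
             beyond b (toℕ p) u ≡ true → beyond b (toℕ p) v ≡ false → ∃[ j ] S (vertex b p) j ≡ true
    bridge b p p<t r Xu Xv =
      let x , y , xy , Xx , Xy = Reach-crosses (beyond b (toℕ p)) r Xu Xv
      in bridgeAt b p p<t x y (symClosure-inv S {x} {y} xy) Xx Xy

    π : V → V → ℕ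
    π i j = ι (not (isNeg (weighing i j)))

    negative+positive : ∀ i j → negativity weighing i j + π i j ≡ 1
    negative+positive i j with isNeg (weighing i j)
    ... | true  = refl
    ... | false = refl

    -- Edges are counted at their lower end, so different branches count disjoint sets and the edges
    -- at the centre are left out.
    positives : Fin M → ℕ
    positives b = ΣFinℕ B λ p → ΣFinℕ (suc (M * B)) λ j → if S (vertex b p) j then π (vertex b p) j else 0

    Σ-≥-term : ∀ {k} (f : Fin k → ℕ) i → f i ≤ ΣFinℕ k f
    Σ-≥-term f zero    = m≤m+n _ _
    Σ-≥-term f (suc i) = ≤-trans (Σ-≥-term (f ∘ suc) i) (m≤n+m _ (f zero))

    -- Each path position contributes an edge in its own row, and edges starting on the path are
    -- positive.
    positives-≥ : ∀ b → (∀ p → toℕ p < t → ∃[ j ] S (vertex b p) j ≡ true) → t ≤ positives b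
    positives-≥ b path = begin
      t                            ≡⟨ Σ-one t ⟨
      ΣFinℕ t (λ _ → 1)            ≤⟨ Σ-mono {t} (λ p → row≥1 (p ↑ˡ s ↑ˡ (a + c)) (onPath p)) ⟩
      ΣFinℕ t (λ p → row (p ↑ˡ s ↑ˡ (a + c)))   ≤⟨ m≤m+n _ _ ⟩
      ΣFinℕ t (λ p → row (p ↑ˡ s ↑ˡ (a + c))) + ΣFinℕ s (λ p → row ((t ↑ʳ p) ↑ˡ (a + c)))
        ≡⟨ Σ-split t (λ p → row (p ↑ˡ (a + c))) ⟨
      ΣFinℕ b₀ (λ p → row (p ↑ˡ (a + c)))       ≤⟨ m≤m+n _ _ ⟩
      ΣFinℕ b₀ (λ p → row (p ↑ˡ (a + c))) + ΣFinℕ (a + c) (λ p → row (b₀ ↑ʳ p)) ≡⟨ Σ-split b₀ row ⟨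
      positives b                  ∎
      where
      open ≤-Reasoning
      row : Fin B → ℕ
      row p = ΣFinℕ (suc (M * B)) λ j → if S (vertex b p) j then π (vertex b p) j else 0
      onPath : ∀ p → toℕ (p ↑ˡ s ↑ˡ (a + c)) < t
      onPath p = subst (_< t) (sym (trans (Finₚ.toℕ-↑ˡ (p ↑ˡ s) (a + c)) (Finₚ.toℕ-↑ˡ p s))) (Finₚ.toℕ<n p)
      π≡1 : ∀ p j → toℕ p < t → π (vertex b p) j ≡ 1
      π≡1 p zero    p<t = refl
      π≡1 p (suc j) p<t rewrite pos-vertex b p | <⇒<ᵇ≡true p<t = refl
      row≥1 : ∀ p → toℕ p < t → 1 ≤ row p
      row≥1 p p<t with j , e ← path p p<t = ≤-trans (entry≥1 j e)
          (Σ-≥-term (λ j → if S (vertex b p) j then π (vertex b p) j else 0) j)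
        where
        entry≥1 : ∀ j → S (vertex b p) j ≡ true → 1 ≤ (if S (vertex b p) j then π (vertex b p) j else 0)
        entry≥1 j e rewrite e | π≡1 p j p<t = ≤-refl

    twoBranches : ∀ {b b′} → b ≢ b′ → t ≤ positives b → t ≤ positives b′ → negs weighing S + (t + t) ≤ size S
    twoBranches {b} {b′} b≢b′ p p′ = begin
      negs weighing S + (t + t) ≤⟨ +-monoʳ-≤ (negs weighing S) (+-mono-≤ p p′) ⟩
      negs weighing S + (positives b + positives b′) ≤⟨ +-monoʳ-≤ (negs weighing S) (Σ-pair positives b≢b′) ⟩
      negs weighing S + ΣFinℕ M positives ≡⟨ cong (λ x → negs weighing S + x)
          (Σ-combine M (λ i → ΣFinℕ (suc (M * B)) λ j → if S (suc i) j then π (suc i) j else 0)) ⟨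
      negs weighing S + ΣFinℕ (M * B) (λ i → ΣFinℕ (suc (M * B)) λ j → if S (suc i) j then π (suc i) j else 0)
        ≤⟨ +-monoʳ-≤ (negs weighing S)
            (m≤n+m _ (ΣFinℕ (suc (M * B)) λ j → if S zero j then π zero j else 0)) ⟩
      negs weighing S + count π S ≡⟨ count-split {u = negativity weighing} {v = π} S negative+positive ⟩
      size S ∎
      where open ≤-Reasoning

    NegativeAt : Fin (M * B) → Set
    NegativeAt i = ∃[ j ] S (suc i) j ≡ true × t ≤ pos i

    negativeAt : ∀ i → 0 < lowerNegs weighing S (suc i) → NegativeAt i
    negativeAt i p with j , q ← Σ-<⇒∃ {f = λ _ → 0}
        (subst (_< lowerNegs weighing S (suc i)) (sym (Σ-zero {suc (M * B)} λ _ → refl)) p)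
      with _ , Sij , ν>0 ← if-<-if false (S (suc i) j) q = j , Sij , negative⇒right i j ν>0

    module _ (conn : ConnectedSub graph S) where

      -- A walk from one branch's blob to the other's crosses every cut along the path of branch
      -- `i`.
      crossed : ∀ {i j} → NegativeAt i → NegativeAt j → branch i ≢ branch j → t ≤ positives (branch i)
      crossed {i} {j} (x , Six , t≤i) (y , Sjy , t≤j) i≢j = positives-≥ (branch i) λ p p<t →
        bridge (branch i) p p<t (conn (suc i) (suc j) (x , inj₂ Six) (y , inj₂ Sjy))
          (beyond-intro i refl (<-≤-trans p<t t≤i)) (beyond-other j i≢j)

      -- More than `s * a` negative edges cannot lie in one branch. Two branches then contribute `t`
      -- positive path edges each, which makes `S` too large.
      negs-≤ : size S < suc (s * a) + (t + t) → negs weighing S ≤ s * a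
      negs-≤ small = ≮⇒≥ λ many →
        let i , i∈ = someNegative many
            j , j∈ , i≢j = otherBranch many (branch i)
        in <⇒≱ small (≤-trans (+-monoˡ-≤ (t + t) many)
             (twoBranches i≢j (crossed i∈ j∈ i≢j) (crossed j∈ i∈ (i≢j ∘ sym))))
        where
        someNegative : s * a < negs weighing S → ∃[ i ] NegativeAt i
        someNegative many with Σ-<⇒∃ {f = λ _ → 0} {g = lowerNegs weighing S}
            (≤-<-trans (≤-reflexive (Σ-zero {suc (M * B)} λ _ → refl)) (≤-<-trans z≤n many))
        ... | zero  , p = contradiction (subst (0 <_) (lowerNegs-centre S) p) λ ()
        ... | suc i , p = i , negativeAt i p
        otherBranch : s * a < negs weighing S → ∀ b → ∃[ j ] NegativeAt j × b ≢ branch j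
        otherBranch many b with Σ-<⇒∃ {f = within b} {g = lowerNegs weighing S}
            (subst (_< negs weighing S) (sym (Σwithin b)) many)
        ... | zero  , p = contradiction (subst (0 <_) (lowerNegs-centre S) p) λ ()
        ... | suc i , p with b Finₚ.≟ branch i
        ...   | no b≢ = i , negativeAt i p , b≢
        -- Inside branch `b`, `within b` counts the whole row of `up`, which the row of `S` cannot
        -- exceed.
        ...   | yes _ = contradiction p
            (≤⇒≯ (≤-trans (Σ-mono (λ j → entry j)) (≤-reflexive (sym (+-identityʳ _)))))
          where
          entry : ∀ j → (if S (suc i) j then negativity weighing (suc i) j else 0)
                        ≤ (if up (suc i) j then negativity weighing (suc i) j else 0)
          entry j with S (suc i) j in Sij
          ... | false = z≤n
          ... | true rewrite S⊑up (suc i) j Sij = ≤-refl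

  -- Here k = 2sa + 1, and sa < 2t puts `k` below the size sa + 1 + 2t that two branches would
  -- require. So at most sa of the `k` edges are negative.
  localPos : s * a < t + t → LocalPos (suc (s * a + s * a)) graph weighing
  localPos sa<2t S edgeSet size≡ conn = 2negs<size⇒wt>0 graph weighing S
    (subst (negs weighing S + negs weighing S <_) (sym size≡) (s≤s (+-mono-≤ bound bound)))
    where
    S⊑up : S ⊑ up
    S⊑up i j e with i<j , ij ← edgeSet i j e = trans (sym (E≡up i j)) (true∧ i<j ij)
    bound : negs weighing S ≤ s * a
    bound = negs-≤ S S⊑up conn (subst (_< suc (s * a) + (t + t)) (sym size≡) (s≤s (+-monoʳ-< (s * a) sa<2t)))

-- Numerical estimates for average degree and total weight.

/-≤ : ∀ p q a b → p ℤ.* + suc b ℤ.≤ q ℤ.* + suc a → p / suc a ℚ.≤ q / suc b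
/-≤ p q a b le = ℚₚ.toℚᵘ-cancel-≤ (ℚᵘₚ.≤-respʳ-≃ (ℚᵘₚ.≃-sym (ℚₚ.toℚᵘ-fromℚᵘ (ℚᵘ.mkℚᵘ q b)))
  (ℚᵘₚ.≤-respˡ-≃ (ℚᵘₚ.≃-sym (ℚₚ.toℚᵘ-fromℚᵘ (ℚᵘ.mkℚᵘ p a))) (ℚᵘ.*≤* le)))

/-≤⁻¹ : ∀ p q a b → p / suc a ℚ.≤ q / suc b → p ℤ.* + suc b ℤ.≤ q ℤ.* + suc a
/-≤⁻¹ p q a b le = ℚᵘₚ.drop-*≤* (ℚᵘₚ.≤-respʳ-≃ (ℚₚ.toℚᵘ-fromℚᵘ (ℚᵘ.mkℚᵘ q b))
  (ℚᵘₚ.≤-respˡ-≃ (ℚₚ.toℚᵘ-fromℚᵘ (ℚᵘ.mkℚᵘ p a)) (ℚₚ.toℚᵘ-mono-≤ le)))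

avgDeg≥8⇒dense : ∀ G → + 8 / 1 ℚ.≤ avgDeg G → 4 * n G ≤ numEdges G
avgDeg≥8⇒dense record { n = zero } _ = z≤n
avgDeg≥8⇒dense G@record { n = suc x } le = *-cancelˡ-≤ 2
  (≤-trans (≤-reflexive (lemma (suc x)))
      (ℤₚ.drop‿+≤+ (subst (+ (8 * suc x) ℤ.≤_) (ℤₚ.*-identityʳ (+ (2 * numEdges G)))
     (/-≤⁻¹ (+ 8) (+ (2 * numEdges G)) 0 x le))))
  where
  lemma : ∀ x → 2 * (4 * x) ≡ 8 * x
  lemma = solve-∀

-- The numerator of `q` is an integer below 8 times the denominator, hence smaller by at least 1;
-- that 1, times the number of vertices, is the slack allowed in the hypothesis.
≤avgDeg : ∀ q G → 0 < n G → q ℚ.< + 8 / 1 →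
          8 * n G * ℚ.denominatorℕ q ≤ 2 * numEdges G * ℚ.denominatorℕ q + n G → q ℚ.≤ avgDeg G
≤avgDeg q@(mkℚ p d _) G@record { n = suc x } _ (ℚ.*<* q<8) le =
  subst (ℚ._≤ avgDeg G) (ℚₚ.↥p/↧p≡p q) (/-≤ p (+ (2 * numEdges G)) d x
    (subst (p ℤ.* + suc x ℤ.≤_) (ℤₚ.pos-* (2 * numEdges G) (suc d)) (cross p q<8)))
  where
  cross : ∀ p → p ℤ.* + 1 ℤ.< + 8 ℤ.* + suc d → p ℤ.* + suc x ℤ.≤ + (2 * numEdges G * suc d)
  cross ℤ.-[1+ a ] _  = ℤ.-≤+
  cross (+ a)      lt = subst (ℤ._≤ _) (ℤₚ.pos-* a (suc x)) (ℤ.+≤+ (+-cancelʳ-≤ (suc x) _ _ (begin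
    a * suc x + suc x                     ≡⟨ +-comm (a * suc x) (suc x) ⟩
    suc a * suc x                         ≤⟨ *-monoˡ-≤ (suc x) a<8d ⟩
    8 * suc d * suc x                     ≡⟨ lemma (suc d) (suc x) ⟩
    8 * suc x * suc d                     ≤⟨ le ⟩
    2 * numEdges G * suc d + suc x        ∎)))
    where
    open ≤-Reasoning
    a<8d : a < 8 * suc d
    a<8d = ℤₚ.drop‿+<+ (subst₂ ℤ._<_ (ℤₚ.*-identityʳ (+ a)) (sym (ℤₚ.pos-* 8 (suc d))) lt)
    lemma : ∀ d x → 8 * d * x ≡ 8 * x * d
    lemma = solve-∀

-- s ≥ 34 d makes the average degree, which tends to 8 as s grows, exceed 8 − 1/d.
spider-dense : ∀ d x y → let s = suc (34 * d + x) ; M = 2 + y in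
  8 * (1 + M * (suc (s * s) + s + (s + s + (34 * d + x)))) * d
  ≤ 2 * (M * (1 + (suc (s * s) + s * (s + s + (34 * d + x))))) * d
      + (1 + M * (suc (s * s) + s + (s + s + (34 * d + x))))
spider-dense d x y = ≤-trans (m≤m+n _ _) (≤-reflexive (identity d x y))
  where
  identity : ∀ d x y → let s = suc (34 * d + x) ; M = 2 + y in
    8 * (1 + M * (suc (s * s) + s + (s + s + (34 * d + x)))) * d
      + (4 * d * y + 1 + M * (s * (x + 1)) + 4 * (M * s))
    ≡ 2 * (M * (1 + (suc (s * s) + s * (s + s + (34 * d + x))))) * d
      + (1 + M * (suc (s * s) + s + (s + s + (34 * d + x))))
  identity = solve-∀

-- As r = s - 1, a branch has 4s² - s + 2 edges, 2s² of them negative. Its weight is 2 - s, at most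
-- -1 for s ≥ 3.
spider-negative : ∀ M r → 2 ≤ r → let s = suc r in
  M * (1 + (suc (s * s) + s * (s + s + r))) + M ≤ M * (s * (s + s)) + M * (s * (s + s))
spider-negative M (suc (suc z)) _ = ≤-trans (m≤m+n _ (M * z)) (≤-reflexive (identity M z))
  where
  identity : ∀ M z → let s = 3 + z in
    M * (1 + (suc (s * s) + s * (s + s + (2 + z)))) + M + M * z ≡ M * (s * (s + s)) + M * (s * (s + s))
  identity = solve-∀
spider-negative M 1 (s≤s ())

-- From unbounded weighings to collapse, and the two ranges of α.

lower<upper : ∀ (α : ℝ) {p q} → lower α p → upper α q → p ℚ.< q
lower<upper α {p} {q} lp uq with ℚₚ.<-cmp p q
... | tri< p<q _ _    = p<q
... | tri≈ _ refl _   = ⊥-elim (disjoint α p lp uq)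
... | tri> _ _ q<p    = ⊥-elim (disjoint α q (lower-closed α q p q<p lp) uq)

-- This refutes forcing (with C = 0) and every constant of weak forcing at the same time.
Unbounded : ℝ → ℕ → Set
Unbounded α k = ∀ C N → Σ Graph λ G → InC α G × N ≤ n G ×
  Σ (Weighing G) λ w → LocalPos k G w × wt G w (E G) ℤ.< C

unbounded⇒collapses : ∀ {α k} → Unbounded α k → Collapses α k
unbounded⇒collapses {α} {k} unb = not-forcing , λ { (_ , C , N , bound) →
    let G , G∈ , N≤ , w , local , lt = unb C N in ℤₚ.<⇒≱ lt (bound G G∈ N≤ w local) }
  where
  not-forcing : ¬ Forcing α k
  not-forcing (N , force) = let G , G∈ , N≤ , w , local , lt = unb (+ 0) N
                            in ℤₚ.<-asym lt (force G G∈ N≤ w local)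

very-negative : ∀ G (w : Weighing G) S M C → size S + M ≤ negs w S + negs w S → ∣ C ∣ < M → wt G w S ℤ.< C
very-negative G w S M C le C<M = ℤₚ.≰⇒> λ C≤wt → <⇒≱ C<M (ℤₚ.drop‿+≤+ (begin
  + M                         ≡⟨ ℤₚ.+-identityˡ (+ M) ⟨
  + 0 ℤ.+ + M                 ≡⟨ cong (λ x → x ℤ.+ + M) (ℤₚ.+-inverseˡ C) ⟨
  (ℤ.- C ℤ.+ C) ℤ.+ + M       ≤⟨ ℤₚ.+-monoˡ-≤ (+ M) (ℤₚ.+-monoʳ-≤ (ℤ.- C) C≤wt) ⟩
  (ℤ.- C ℤ.+ wt G w S) ℤ.+ + M ≡⟨ ℤₚ.+-assoc (ℤ.- C) (wt G w S) (+ M) ⟩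
  ℤ.- C ℤ.+ (wt G w S ℤ.+ + M) ≤⟨ ℤₚ.+-monoʳ-≤ (ℤ.- C) wt+M≤0 ⟩
  ℤ.- C ℤ.+ + 0               ≡⟨ ℤₚ.+-identityʳ (ℤ.- C) ⟩
  ℤ.- C                       ≤⟨ -i≤∣i∣ C ⟩
  + ∣ C ∣                     ∎))
  where
  open ℤₚ.≤-Reasoning
  -i≤∣i∣ : ∀ i → ℤ.- i ℤ.≤ + ∣ i ∣
  -i≤∣i∣ (+ zero)      = ℤₚ.≤-refl
  -i≤∣i∣ (+ suc _)     = ℤ.-≤+
  -i≤∣i∣ ℤ.-[1+ _ ]    = ℤₚ.≤-refl
  2ν : ℤ
  2ν = + (negs w S + negs w S)
  wt+M≤0 : wt G w S ℤ.+ + M ℤ.≤ + 0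
  wt+M≤0 = ℤₚ.≮⇒≥ λ pos → ℤₚ.<⇒≱ (ℤₚ.+-monoˡ-< 2ν pos) (begin
    (wt G w S ℤ.+ + M) ℤ.+ 2ν   ≡⟨ ℤₚ.+-assoc (wt G w S) (+ M) 2ν ⟩
    wt G w S ℤ.+ (+ M ℤ.+ 2ν)   ≡⟨ cong (λ x → wt G w S ℤ.+ x) (ℤₚ.+-comm (+ M) 2ν) ⟩
    wt G w S ℤ.+ (2ν ℤ.+ + M)   ≡⟨ ℤₚ.+-assoc (wt G w S) 2ν (+ M) ⟨
    (wt G w S ℤ.+ 2ν) ℤ.+ + M   ≡⟨ cong (λ x → x ℤ.+ + M) (size≡wt+2negs G w S) ⟨
    + (size S + M)              ≤⟨ ℤ.+≤+ le ⟩
    2ν                          ≡⟨ ℤₚ.+-identityˡ 2ν ⟨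
    + 0 ℤ.+ 2ν                  ∎)

module Collapse (α : ℝ) (q : ℚ) (α<q : upper α q) (q<8 : q ℚ.< + 8 / 1) (m : ℕ) where

  d r s k : ℕ
  d = ℚ.denominatorℕ q
  -- The first summand makes the spider dense enough for `q`; the second makes `k` exceed `m`.
  r = 34 * d + m
  s = suc r
  k = suc (s * (s + s) + s * (s + s))

  unbounded : Unbounded α k
  unbounded C N = graph , (connected , α≤avgDeg) , N≤n , weighing , localPos sa<2t
                , very-negative graph weighing (E graph) M C weight (m≤n⇒m≤1+n (s≤s (m≤n+m ∣ C ∣ N)))
    where
    M : ℕ
    -- `N` provides enough vertices, and since each branch weighs at most -1, ∣ C ∣ pushes the total
    -- below `C`.
    M = 2 + (N + ∣ C ∣)
    -- The blob joins s left vertices to 2s right ones by negative edges and to s - 1 by positive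
    -- edges. So sa = 2s² lies just below 2t = 2s² + 2.
    open Spider M (suc (s * s)) s (s + s) r (s≤s z≤n) (s≤s z≤n)
    N≤n : N ≤ suc (M * B)
    N≤n = ≤-trans (≤-trans (m≤m+n N ∣ C ∣) (≤-trans (m≤n+m _ 2) (m≤m*n M B))) (n≤1+n _)
    sa<2t : s * (s + s) < suc (s * s) + suc (s * s)
    sa<2t = s≤s (≤-trans (≤-reflexive (*-distribˡ-+ s s s)) (+-monoʳ-≤ (s * s) (n≤1+n _)))
    weight : size (E graph) + M ≤ negs weighing (E graph) + negs weighing (E graph)
    weight = subst₂ (λ x y → x + M ≤ y + y) (sym numEdges-graph) (sym negs-graph)
        (spider-negative M r (≤-trans (s≤s (s≤s z≤n)) (≤-trans (m≤m*n 34 d) (m≤m+n _ m))))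
    α≤avgDeg : α ≤ʳ avgDeg graph
    α≤avgDeg p p<α = ℚₚ.<-≤-trans (lower<upper α p<α α<q)
      (≤avgDeg q graph (s≤s z≤n) q<8
        (subst (λ e → 8 * suc (M * B) * d ≤ 2 * e * d + suc (M * B)) (sym numEdges-graph)
            (spider-dense d m (N + ∣ C ∣))))

  m<k : m < k
  m<k = s≤s (≤-trans (≤-trans (m≤n+m m (34 * d)) (n≤1+n r)) (≤-trans (m≤m*n s (s + s)) (m≤m+n _ _)))

theorem1p3 : ((α : ℝ) → α <ʳ (+ 8 / 1) →
    ∀ (m : ℕ) → ∃[ k ] (m < k × Collapses α k))
    × ((α : ℝ) → α ≥ʳ (+ 8 / 1) →
    ∀ (k : ℕ) → 1 ≤ k → Forcing α k)
theorem1p3 = collapse , forcing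
  where
  collapse : (α : ℝ) → α <ʳ (+ 8 / 1) → ∀ (m : ℕ) → ∃[ k ] (m < k × Collapses α k)
  collapse α (q , α<q , q<8) m = k , m<k , unbounded⇒collapses {α} unbounded
    where open Collapse α q α<q q<8 m
  forcing : (α : ℝ) → α ≥ʳ (+ 8 / 1) → ∀ (k : ℕ) → 1 ≤ k → Forcing α k
  forcing α α≥8 k 1≤k with N , force ← forcing-of-dense k 1≤k =
    N , λ G (conn , α≤) → force G conn (avgDeg≥8⇒dense G
      -- An average degree below 8 would lie in the lower cut of α, and membership of `G` would
      -- place it below itself.
      (ℚₚ.≮⇒≥ λ lt → ℚₚ.<-irrefl refl (α≤ _ (α≥8 _ lt))))
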